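{- For the adversarially robust monotone submodular maximization problem ARMSM$(m,K)$ under a single knapsack constraint, there exists an algorithm that outputs a set $\mathcal S\subseteq V$ with $\tilde{O}(K+m)$ elements such that, for any set $E\subseteq V$ of at most $m$ removed items, one can compute from $\mathcal S$ a set $Z \subseteq V \setminus E$ with cost $c(Z)\le K$ and $f(Z)\ge \alpha\, f(\mathcal{OPT}(V\setminus E))$ for some absolute constant $\alpha>0$.
   Context: $V$ is a finite ground set and $f:2^V\to\mathbb R_{\ge 0}$ is monotone ($f(S)\le f(T)$ for $S\subseteq T$) and submodular ($f(T\cup\{e\})-f(T)\le f(S\cup\{e\})-f(S)$ for $S\subseteq T\subseteq V$, $e\in V$). Each element $e\in V$ has a cost $c(e)\ge 1$ (costs are normalized so the minimum cost is at least $1$), the cost of a set is $c(S)=\sum_{e\in S}c(e)$, and $K$ is the knapsack budget. For $W\subseteq V$, $\mathcal{OPT}(W)$ denotes a set $S\subseteq W$ with $c(S)\le K$ maximizing $f(S)$. In ARMSM$(m,K)$ the algorithm must produce a summary $\mathcal S\subseteq V$ before the removal set $E$ (any set of at most $m$ elements, chosen adversarially, possibly depending on $\mathcal S$) is revealed; it is an $\alpha$-approximation if for every such $E$ there is a feasible $Z$ obtained from $\mathcal S$ with $f(Z)\ge\alpha f(\mathcal{OPT}(V\setminus E))$. $\tilde O(\cdot)$ hides polylogarithmic factors.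
   Formalization: The values of f, the costs c(e) and the budget K are taken to be rational numbers instead of real numbers. -}

module Defs where

open import Data.Nat as ℕ using (ℕ; zero; suc)
open import Data.Nat.Logarithm using (⌊log₂_⌋)
open import Data.Integer as ℤ using (ℤ)
open import Data.Bool using (Bool; true; false)
open import Data.Vec using (Vec; []; _∷_)
open import Data.Fin using (Fin)
import Data.Fin as F
open import Data.Fin.Subset using (Subset; _⊆_; _∪_; _∩_; ∁; ⁅_⁆; ∣_∣)
open import Data.Rational using (ℚ; 0ℚ; 1ℚ; _+_; _-_; _*_; _≤_; _<_; floor)
open import Data.Product using (Σ; _×_; ∃; ∃-syntax)

cost : ∀ {n} → (Fin n → ℚ) → Subset n → ℚ
cost c []            = 0ℚ
cost c (true  ∷ S)   = c F.zero + cost (λ i → c (F.suc i)) S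
cost c (false ∷ S)   = cost (λ i → c (F.suc i)) S

NonNegative : ∀ {n} → (Subset n → ℚ) → Set
NonNegative f = ∀ S → 0ℚ ≤ f S

Monotone : ∀ {n} → (Subset n → ℚ) → Set
Monotone f = ∀ S T → S ⊆ T → f S ≤ f T

Submodular : ∀ {n} → (Subset n → ℚ) → Set
Submodular f = ∀ S T e → S ⊆ T →
  f (T ∪ ⁅ e ⁆) - f T ≤ f (S ∪ ⁅ e ⁆) - f S

-- Normalised costs: every cost is at least 1.
CostsAtLeastOne : ∀ {n} → (Fin n → ℚ) → Set
CostsAtLeastOne c = ∀ e → 1ℚ ≤ c e

FeasibleIn : ∀ {n} → (Fin n → ℚ) → ℚ → Subset n → Subset n → Set
FeasibleIn c K W S = S ⊆ W × cost c S ≤ K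

IsOPT : ∀ {n} → (Subset n → ℚ) → (Fin n → ℚ) → ℚ → Subset n → Subset n → Set
IsOPT f c K W S = FeasibleIn c K W S × (∀ T → FeasibleIn c K W T → f T ≤ f S)

-- ⌊K⌋ as a natural number (K ≥ 0 in our use)
natFloor : ℚ → ℕ
natFloor K = ℤ.∣ floor K ∣

SoftBound : ℕ → ℕ → ℚ → ℕ → ℕ
SoftBound C d K m =
  C ℕ.* (natFloor K ℕ.+ m ℕ.+ 1) ℕ.* (⌊log₂ (natFloor K ℕ.+ m ℕ.+ 2) ⌋ ℕ.+ 1) ℕ.^ d

RobustSummary : (α : ℚ) → (C d : ℕ) → Set
RobustSummary α C d =
  ∀ (n : ℕ) (f : Subset n → ℚ) (c : Fin n → ℚ) (K : ℚ) (m : ℕ) →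
  NonNegative f → Monotone f → Submodular f → CostsAtLeastOne c → 0ℚ ≤ K →
  ∃[ 𝒮 ] (∣ 𝒮 ∣ ℕ.≤ SoftBound C d K m ×
    (∀ (E : Subset n) → ∣ E ∣ ℕ.≤ m →
      ∃[ Z ] (Z ⊆ 𝒮 ∩ ∁ E × cost c Z ≤ K ×
        (∀ O → IsOPT f c K (∁ E) O → α * f O ≤ f Z))))

{-# OPTIONS --safe #-}
module Submission where

open import Defs
open import Data.Nat using (ℕ)
open import Data.Rational using (ℚ; 0ℚ; _<_)
open import Data.Product using (Σ; _×_; ∃; ∃-syntax)

open import Data.Bool using (true; false) renaming (_≟_ to _≟ᵇ_)
open import Data.Empty using (⊥-elim)
open import Data.Fin using (Fin)
import Data.Fin as F
open import Data.Fin.Properties using (any?)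
open import Data.Fin.Subset
  using (Subset; _∈_; _∉_; _⊆_; _∪_; _∩_; ∁; ⁅_⁆; ∣_∣; ⊥)
open import Data.Fin.Subset.Properties
open import Data.Integer as ℤ using (-[1+_])
import Data.Integer.Properties as ℤₚ
open import Data.Nat as ℕ using (zero; suc; z≤n; s≤s)
open import Data.Nat.DivMod using (m/n*n≤m; m≡m%n+[m/n]*n; m%n<n)
open import Data.Nat.Logarithm
  using (⌊log₂_⌋; ⌊log₂⌋-mono-≤; ⌊log₂[2^n]⌋≡n; ⌊log₂[2*b]⌋≡1+⌊log₂b⌋)
import Data.Nat.Properties as ℕₚ
open import Data.Nat.Tactic.RingSolver using (solve-∀)
open import Data.Product using (_,_; proj₁; proj₂)
open import Data.Rational
  using (mkℚ; 1ℚ; ½; _+_; _*_; _≤_; nonNegative; toℚᵘ)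
open import Data.Rational.Properties
open import Data.Rational.Solver using (module +-*-Solver)
open import Data.Rational.Unnormalised as ℚᵘ using (mkℚᵘ; *≤*; *<*; *≡*)
import Data.Rational.Unnormalised.Properties as ℚᵘₚ
open import Data.Sum using (_⊎_; inj₁; inj₂)
open import Data.Vec using ([]; _∷_; here; there; tabulate)
open import Data.Vec.Properties using (≡-dec; lookup∘tabulate; []=⇒lookup; lookup⇒[]=)
open import Function using (_∘_)
open import Relation.Binary.PropositionalEquality
  using (_≡_; refl; sym; trans; cong; cong₂; subst; module ≡-Reasoning)
open import Relation.Nullary using (¬_; Dec; does; yes; no; contradiction)
open import Relation.Nullary.Decidable using (_×-dec_; ¬?; dec-true)
open +-*-Solver using (solve; _:=_; _:+_; _:*_; _:-_; con)

-- Fix a guess τ of the optimal value. Level i uses the density threshold θ = τ / 2^i and sets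
-- of cost about 2^i: starting from ∅, elements e of marginal value at least θ c(e) are inserted
-- greedily, cheap elements first. Each time the cost class doubles, the greedy set is continued
-- in two disjoint ways, so the greedy sets are the paths of a binary tree of depth R with about
-- 2^R elements per class. A class of cost x is spread over about 2^R x / 2^i disjoint
-- alternatives, so a deletion costs an average path 2^i / 2^R, and some path of level i loses
-- at most 2m 2^i / 2^R of its cost.
-- If that path has reached cost 2^i, its surviving part is worth τ / 2, because each element
-- contributed density θ. Otherwise it rejects every element outside the summary; the elements
-- deleted from it were rejected by the previous level, so they are worth only O(τ m / 2^R), and
-- for 2^R ≥ 4mL the union U of the paths of all L ~ log K levels satisfies f(U) ≤ f(U ∖ E) + τ
-- while every feasible O outside the summary adds at most 4τ to f(U).
-- The m + 1 best singletons are kept as well. One of them survives, and its value determines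
-- the optimum outside them up to a factor O(K), which leaves O(log K) guesses of τ.

private
  variable
    n : ℕ
    a b p q r s : ℚ

-- Ordered-field arithmetic

-- Linear arithmetic: p ≤ q is the sum of the premises, and the ring solver supplies the identity.
by : p ≤ q → a + q ≡ b + p → a ≤ b
by {p} {q} {a} {b} p≤q eq with a ≤? b
... | yes a≤b = a≤b
... | no  a≰b = contradiction
  (<-≤-trans (+-monoˡ-< p (≰⇒> a≰b)) (≤-trans (+-monoʳ-≤ a p≤q) (≤-reflexive eq)))
  (<-irrefl refl)

infixl 5 _⊕_
_⊕_ : p ≤ q → r ≤ s → p + r ≤ q + s
_⊕_ = +-mono-≤

*-monoˡ : 0ℚ ≤ r → p ≤ q → r * p ≤ r * q
*-monoˡ {r} 0≤r p≤q = *-monoˡ-≤-nonNeg r {{nonNegative 0≤r}} p≤q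

*-nonNeg : 0ℚ ≤ p → 0ℚ ≤ q → 0ℚ ≤ p * q
*-nonNeg {p} 0≤p 0≤q = ≤-trans (≤-reflexive (sym (*-zeroʳ p))) (*-monoˡ 0≤p 0≤q)

0≤1 : 0ℚ ≤ 1ℚ
0≤1 = nonNegative⁻¹ 1ℚ

p≤q+p : 0ℚ ≤ q → p ≤ q + p
p≤q+p {q} {p} 0≤q = ≤-trans (≤-reflexive (sym (+-identityˡ p))) (+-monoˡ-≤ p 0≤q)

p≤p+q : 0ℚ ≤ q → p ≤ p + q
p≤p+q {q} {p} 0≤q = ≤-trans (≤-reflexive (sym (+-identityʳ p))) (+-monoʳ-≤ p 0≤q)

+-nonNeg : 0ℚ ≤ p → 0ℚ ≤ q → 0ℚ ≤ p + q
+-nonNeg 0≤p 0≤q = ≤-trans 0≤p (p≤p+q 0≤q)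

ι : ℕ → ℚ
ι zero    = 0ℚ
ι (suc n) = 1ℚ + ι n

ι-nonNeg : ∀ n → 0ℚ ≤ ι n
ι-nonNeg zero    = ≤-refl
ι-nonNeg (suc n) = +-mono-≤ 0≤1 (ι-nonNeg n)

ι-mono : ∀ {m n} → m ℕ.≤ n → ι m ≤ ι n
ι-mono {n = n} z≤n = ι-nonNeg n
ι-mono (s≤s m≤n)   = +-monoʳ-≤ 1ℚ (ι-mono m≤n)

ι-+ : ∀ m n → ι (m ℕ.+ n) ≡ ι m + ι n
ι-+ zero    n = sym (+-identityˡ (ι n))
ι-+ (suc m) n = trans (cong (1ℚ +_) (ι-+ m n)) (sym (+-assoc 1ℚ (ι m) (ι n)))

ι-* : ∀ m n → ι (m ℕ.* n) ≡ ι m * ι n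
ι-* zero    n = sym (*-zeroˡ (ι n))
ι-* (suc m) n = begin
  ι (n ℕ.+ m ℕ.* n)     ≡⟨ ι-+ n (m ℕ.* n) ⟩
  ι n + ι (m ℕ.* n)     ≡⟨ cong (ι n +_) (ι-* m n) ⟩
  ι n + ι m * ι n       ≡⟨ solve 2 (λ x y → y :+ x :* y := (con 1ℚ :+ x) :* y) refl (ι m) (ι n) ⟩
  (1ℚ + ι m) * ι n      ∎
  where open ≡-Reasoning

ι-2^suc : ∀ k → ι (2 ℕ.^ suc k) ≡ ι (2 ℕ.^ k) + ι (2 ℕ.^ k)
ι-2^suc k = trans (cong (λ j → ι (2 ℕ.^ k ℕ.+ j)) (ℕₚ.+-identityʳ (2 ℕ.^ k)))
                  (ι-+ (2 ℕ.^ k) (2 ℕ.^ k))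

half : ℕ → ℚ
half zero    = 1ℚ
half (suc k) = ½ * half k

half-suc : ∀ k → half (suc k) + half (suc k) ≡ half k
half-suc k = solve 1 (λ x → con ½ :* x :+ con ½ :* x := x) refl (half k)

half-nonNeg : ∀ k → 0ℚ ≤ half k
half-nonNeg zero    = 0≤1
half-nonNeg (suc k) = *-nonNeg (nonNegative⁻¹ ½) (half-nonNeg k)

2^*half : ∀ k → ι (2 ℕ.^ k) * half k ≡ 1ℚ
2^*half zero    = refl
2^*half (suc k) = begin
  ι (2 ℕ.^ suc k) * (½ * half k)              ≡⟨ cong (_* (½ * half k)) (ι-2^suc k) ⟩
  (ι (2 ℕ.^ k) + ι (2 ℕ.^ k)) * (½ * half k)  ≡⟨ solve 2 (λ x y → (x :+ x) :* (con ½ :* y) := x :* y) refl (ι (2 ℕ.^ k)) (half k) ⟩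
  ι (2 ℕ.^ k) * half k                        ≡⟨ 2^*half k ⟩
  1ℚ                                          ∎
  where open ≡-Reasoning

room-insert : ∀ N → r ≤ p + ι (suc N) * b → b ≤ q → r ≤ (p + q) + ι N * b
room-insert {r} {p} {b} {q} N room b≤q = by (room ⊕ b≤q)
  (solve 5 (λ r p x q b → r :+ ((p :+ (con 1ℚ :+ x) :* b) :+ q) := ((p :+ q) :+ x :* b) :+ (r :+ b)) refl
    r p (ι N) q b)

next-class : ∀ d b → ι (2 ℕ.^ suc d) * b ≡ r → ι (2 ℕ.^ d) * (b + b) ≡ r
next-class d b eq = trans (solve 2 (λ x b → x :* (b :+ b) := (x :+ x) :* b) refl (ι (2 ℕ.^ d)) b)
                      (trans (cong (_* b) (sym (ι-2^suc d))) eq)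

1≤2^ : ∀ d → 1ℚ ≤ ι (2 ℕ.^ d)
1≤2^ d = ι-mono (ℕₚ.m^n>0 2 d)

-- While at least one further class is left, everything in the class from `b` to `b + b` costs at
-- most the cap `r`.
2b≤cap : ∀ d → 0ℚ ≤ b → ι (2 ℕ.^ suc d) * b ≡ r → b + b ≤ r
2b≤cap {b} {r} d 0≤b eq = begin
  b + b                     ≡⟨ *-identityʳ (b + b) ⟨
  (b + b) * 1ℚ              ≤⟨ *-monoˡ (+-mono-≤ 0≤b 0≤b) (1≤2^ d) ⟩
  (b + b) * ι (2 ℕ.^ d)     ≡⟨ *-comm (b + b) (ι (2 ℕ.^ d)) ⟩
  ι (2 ℕ.^ d) * (b + b)     ≡⟨ next-class d b eq ⟩
  r                         ∎
  where open ≤-Reasoning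

-- Twice this is the factor 32, the inverse of the approximation ratio `half 5`.
16* : ℚ → ℚ
16* v = let 2v = v + v ; 4v = 2v + 2v ; 8v = 4v + 4v in 8v + 8v

half-32 : ∀ v → half 5 * (16* v + 16* v) ≡ v
half-32 = solve 1 (λ v → let 2v = v :+ v ; 4v = 2v :+ 2v ; 8v = 4v :+ 4v ; 16v = 8v :+ 8v in
  (con ½ :* (con ½ :* (con ½ :* (con ½ :* (con ½ :* con 1ℚ))))) :* (16v :+ 16v) := v) refl

16*-inflationary : ∀ {v} → 0ℚ ≤ v → v ≤ 16* v
16*-inflationary 0≤v = ≤-trans (p≤p+q 0≤v) (≤-trans (p≤p+q 0≤2v) (≤-trans (p≤p+q 0≤4v) (p≤p+q (+-nonNeg 0≤4v 0≤4v))))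
  where
  0≤2v = +-nonNeg 0≤v 0≤v
  0≤4v = +-nonNeg 0≤2v 0≤2v

-- At the first power where the multiple of `Δ` exceeds `2v`, the previous multiple was at most
-- `2v`, so this one is at most `4v`. The search selects a guess of the optimum just above twice the
-- attained value `v`.
doubling-search : ∀ {Δ v} → Δ ≤ v + v → ∀ t → ι (2 ℕ.^ t) * Δ ≤ v + v ⊎
  (∃[ s ] (s ℕ.≤ t × v + v < ι (2 ℕ.^ s) * Δ × ι (2 ℕ.^ s) * Δ ≤ (v + v) + (v + v)))
doubling-search {Δ} {v} Δ≤2v zero = inj₁ (subst (_≤ v + v) (sym (*-identityˡ Δ)) Δ≤2v)
doubling-search {Δ} {v} Δ≤2v (suc t) with doubling-search {v = v} Δ≤2v t
... | inj₂ (s , s≤t , below , above) = inj₂ (s , ℕₚ.m≤n⇒m≤1+n s≤t , below , above)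
... | inj₁ t≤2v with ι (2 ℕ.^ suc t) * Δ ≤? v + v
...   | yes ≤2v = inj₁ ≤2v
...   | no  ≰2v = inj₂ (suc t , ℕₚ.≤-refl , ≰⇒> ≰2v ,
  subst (_≤ (v + v) + (v + v))
    (trans (sym (*-distribʳ-+ Δ (ι (2 ℕ.^ t)) (ι (2 ℕ.^ t)))) (cong (_* Δ) (sym (ι-2^suc t))))
    (+-mono-≤ t≤2v t≤2v))

-- Choice of the parameters

-- For `i ≥ 1` the value `2 ^ (i + 1)` pays for one path of level `i` that has reached its cap, of
-- cost below `2 · 2 ^ i`, and also for a union of paths of levels 1 to `i` of costs at most
-- `2 ^ 1`, ..., `2 ^ i`. The value 0 at level 0 fits every knapsack.
budget : ℕ → ℕ
budget zero    = 0
budget (suc i) = 2 ℕ.^ suc (suc i)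

budget-suc : ∀ i → budget i ℕ.+ 2 ℕ.^ suc i ℕ.≤ budget (suc i)
budget-suc zero    = ℕₚ.m≤m+n 2 2
budget-suc (suc i) = ℕₚ.≤-reflexive (cong (2 ℕ.^ suc (suc i) ℕ.+_) (sym (ℕₚ.+-identityʳ _)))

budget-mono : ∀ i → budget i ℕ.≤ budget (suc i)
budget-mono i = ℕₚ.≤-trans (ℕₚ.m≤m+n (budget i) _) (budget-suc i)

toℚᵘ-ι : ∀ k → toℚᵘ (ι k) ℚᵘ.≃ mkℚᵘ (ℤ.+ k) 0
toℚᵘ-ι zero    = *≡* refl
toℚᵘ-ι (suc k) = ℚᵘₚ.≃-trans (toℚᵘ-homo-+ 1ℚ (ι k)) (ℚᵘₚ.≃-trans (ℚᵘₚ.+-congʳ (toℚᵘ 1ℚ) (toℚᵘ-ι k))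
  (*≡* (cong (λ j → (ℤ.+ 1 ℤ.+ j) ℤ.* ℤ.+ 1) (ℤₚ.*-identityʳ (ℤ.+ k)))))

ι-natFloor : ∀ {K} → 0ℚ ≤ K → ι (natFloor K) ≤ K × K < ι (suc (natFloor K))
ι-natFloor {mkℚ -[1+ a ] d _} (_≤_.*≤* ())
-- Integer division multiplies the quotient by the sign of the denominator; the rewriting removes
-- this factor 1.
ι-natFloor {K@(mkℚ (ℤ.+ a) d _)} _ rewrite ℤₚ.abs-* (ℤ.+ 1) (ℤ.+ (a ℕ./ suc d)) | ℕₚ.+-identityʳ (a ℕ./ suc d) =
  toℚᵘ-cancel-≤ (ℚᵘₚ.≤-respˡ-≃ (ℚᵘₚ.≃-sym (toℚᵘ-ι quotient)) (*≤* lower)) ,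
  toℚᵘ-cancel-< (ℚᵘₚ.<-respʳ-≃ (ℚᵘₚ.≃-sym (toℚᵘ-ι (suc quotient))) (*<* upper))
  where
  quotient = a ℕ./ suc d
  lower : ℤ.+ quotient ℤ.* ℤ.+ suc d ℤ.≤ ℤ.+ a ℤ.* ℤ.+ 1
  lower rewrite sym (ℤₚ.pos-* quotient (suc d)) | ℤₚ.*-identityʳ (ℤ.+ a) = ℤ.+≤+ (m/n*n≤m a (suc d))
  upper : ℤ.+ a ℤ.* ℤ.+ 1 ℤ.< ℤ.+ suc quotient ℤ.* ℤ.+ suc d
  upper rewrite sym (ℤₚ.pos-* (suc quotient) (suc d)) | ℤₚ.*-identityʳ (ℤ.+ a) = ℤ.+<+
    (ℕₚ.≤-<-trans (ℕₚ.≤-reflexive (m≡m%n+[m/n]*n a (suc d)))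
      (ℕₚ.+-monoˡ-< (quotient ℕ.* suc d) (m%n<n a (suc d))))

2^-between : ∀ N → 1 ℕ.≤ N → ∃[ R ] (N ℕ.≤ 2 ℕ.^ R × 2 ℕ.^ R ℕ.≤ 2 ℕ.* N)
2^-between (suc zero)    _ = 0 , s≤s z≤n , s≤s z≤n
2^-between (suc (suc N)) _ with 2^-between (suc N) (s≤s z≤n)
... | R , N≤ , ≤2N with suc (suc N) ℕ.≤? 2 ℕ.^ R
...   | yes N+2≤ = R , N+2≤ , ℕₚ.≤-trans ≤2N (ℕₚ.*-monoʳ-≤ 2 (ℕₚ.n≤1+n (suc N)))
...   | no  N+2≰ = suc R ,
  ℕₚ.≤-trans (ℕₚ.≤-trans (s≤s (s≤s (ℕₚ.m≤m+n N N))) (ℕₚ.≤-reflexive (doubled N))) (ℕₚ.*-monoʳ-≤ 2 N≤) ,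
  ℕₚ.*-monoʳ-≤ 2 (ℕₚ.<⇒≤ (ℕₚ.≰⇒> N+2≰))
  where
  doubled : ∀ N → suc (suc (N ℕ.+ N)) ≡ 2 ℕ.* suc N
  doubled = solve-∀

-- Chooses the number of levels: the last `L` whose budget still fits, so that `4 · 2 ^ L` exceeds
-- the knapsack budget.
budget-between : ∀ k → ∃[ L ] (budget L ℕ.≤ k × suc k ℕ.≤ 2 ℕ.^ suc (suc L))
budget-between zero = 0 , z≤n , s≤s z≤n
budget-between (suc k) with budget-between k
... | L , ≤k , k< with suc (suc k) ℕ.≤? 2 ℕ.^ suc (suc L)
...   | yes k+2≤ = L , ℕₚ.m≤n⇒m≤1+n ≤k , k+2≤
...   | no  k+2≰ = suc L , ℕₚ.≤-pred (ℕₚ.≰⇒> k+2≰) ,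
  ℕₚ.≤-trans (s≤s k<) (ℕₚ.+-mono-≤ (ℕₚ.m^n>0 2 (suc (suc L)))
    (ℕₚ.≤-reflexive (sym (ℕₚ.+-identityʳ (2 ℕ.^ suc (suc L))))))

2^-cancel-≤ : ∀ {a b} → 2 ℕ.^ a ℕ.≤ 2 ℕ.^ b → a ℕ.≤ b
2^-cancel-≤ {a} {b} le = subst (ℕ._≤ b) (⌊log₂[2^n]⌋≡n a)
  (subst (⌊log₂ 2 ℕ.^ a ⌋ ℕ.≤_) (⌊log₂[2^n]⌋≡n b) (⌊log₂⌋-mono-≤ le))

n≤2^1+log : ∀ N → 1 ℕ.≤ N → N ℕ.≤ 2 ℕ.^ (⌊log₂ N ⌋ ℕ.+ 1)
n≤2^1+log N@(suc _) 1≤N with 2^-between N 1≤N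
... | R , N≤ , ≤2N = ℕₚ.≤-trans N≤ (ℕₚ.^-monoʳ-≤ 2 (begin
  R                   ≡⟨ ⌊log₂[2^n]⌋≡n R ⟨
  ⌊log₂ 2 ℕ.^ R ⌋     ≤⟨ ⌊log₂⌋-mono-≤ ≤2N ⟩
  ⌊log₂ 2 ℕ.* N ⌋     ≡⟨ ⌊log₂[2*b]⌋≡1+⌊log₂b⌋ N ⟩
  1 ℕ.+ ⌊log₂ N ⌋     ≡⟨ ℕₚ.+-comm 1 ⌊log₂ N ⌋ ⟩
  ⌊log₂ N ⌋ ℕ.+ 1     ∎))
  where open ℕₚ.≤-Reasoning

n≤2^n : ∀ n → n ℕ.≤ 2 ℕ.^ n
n≤2^n zero    = z≤n
n≤2^n (suc n) = ℕₚ.+-mono-≤ (ℕₚ.m^n>0 2 n)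
  (ℕₚ.≤-trans (n≤2^n n) (ℕₚ.≤-reflexive (sym (ℕₚ.+-identityʳ (2 ℕ.^ n)))))

-- L is the number of levels, R the depth of the trees.
record Parameters (k m : ℕ) : Set where
  field
    L R          : ℕ
    budget≤      : budget L ℕ.≤ k
    k<           : suc k ℕ.≤ 2 ℕ.^ suc (suc L)
    L≤R          : L ℕ.≤ R
    deletions    : (m ℕ.+ m ℕ.+ (m ℕ.+ m)) ℕ.* 1 ℕ.≤ 2 ℕ.^ R
    deletions-L  : (m ℕ.+ m ℕ.+ (m ℕ.+ m)) ℕ.* L ℕ.≤ 2 ℕ.^ R
    size         : suc m ℕ.+ suc L ℕ.* (L ℕ.* (R ℕ.* 2 ℕ.^ R)) ℕ.≤
                   81 ℕ.* (k ℕ.+ m ℕ.+ 1) ℕ.* (⌊log₂ k ℕ.+ m ℕ.+ 2 ⌋ ℕ.+ 1) ℕ.^ 4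

-- `2 ^ R` is taken between `4MG` and `8MG`, where `G` bounds `L`. The lower end is at least `4m`
-- and `4mL`, which absorbs the deletions; the upper end keeps the trees near-linear in `k + m`.
parameters : ∀ k m → Parameters k m
parameters k m with budget-between k
... | L , budget≤ , k< = build (2^-between (4 ℕ.* M ℕ.* G) 1≤N)
  where
  M = k ℕ.+ m ℕ.+ 2
  S = k ℕ.+ m ℕ.+ 1
  G = ⌊log₂ M ⌋ ℕ.+ 1
  1≤G : 1 ℕ.≤ G
  1≤G = ℕₚ.m≤n+m 1 ⌊log₂ M ⌋
  1≤S : 1 ℕ.≤ S
  1≤S = ℕₚ.m≤n+m 1 (k ℕ.+ m)
  1≤M : 1 ℕ.≤ M
  1≤M = ℕₚ.≤-trans (s≤s z≤n) (ℕₚ.m≤n+m 2 (k ℕ.+ m))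
  M≤N : M ℕ.≤ 4 ℕ.* M ℕ.* G
  M≤N = ℕₚ.≤-trans (ℕₚ.m≤n*m M 4) (ℕₚ.m≤m*n (4 ℕ.* M) G {{ℕ.>-nonZero 1≤G}})
  1≤N : 1 ℕ.≤ 4 ℕ.* M ℕ.* G
  1≤N = ℕₚ.≤-trans 1≤M M≤N
  k≤M : k ℕ.≤ M
  k≤M = ℕₚ.≤-trans (ℕₚ.m≤m+n k m) (ℕₚ.m≤m+n (k ℕ.+ m) 2)
  m≤M : m ℕ.≤ M
  m≤M = ℕₚ.≤-trans (ℕₚ.m≤n+m m k) (ℕₚ.m≤m+n (k ℕ.+ m) 2)
  2^L≤M : ∀ L → budget L ℕ.≤ k → 2 ℕ.^ L ℕ.≤ M
  2^L≤M zero    _  = 1≤M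
  2^L≤M (suc L) b≤ = ℕₚ.≤-trans (ℕₚ.^-monoʳ-≤ 2 (ℕₚ.n≤1+n (suc L))) (ℕₚ.≤-trans b≤ k≤M)
  L<G : suc L ℕ.≤ G
  L<G = ℕₚ.≤-trans (ℕₚ.≤-reflexive (ℕₚ.+-comm 1 L)) (ℕₚ.+-monoˡ-≤ 1
    (subst (ℕ._≤ ⌊log₂ M ⌋) (⌊log₂[2^n]⌋≡n L) (⌊log₂⌋-mono-≤ (2^L≤M L budget≤))))
  L≤G : L ℕ.≤ G
  L≤G = ℕₚ.<⇒≤ L<G
  4m≤4M : m ℕ.+ m ℕ.+ (m ℕ.+ m) ℕ.≤ 4 ℕ.* M
  4m≤4M = ℕₚ.≤-trans (ℕₚ.≤-reflexive (quadruple m)) (ℕₚ.*-monoʳ-≤ 4 m≤M)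
    where
    quadruple : ∀ m → m ℕ.+ m ℕ.+ (m ℕ.+ m) ≡ 4 ℕ.* m
    quadruple = solve-∀
  build : ∃[ R ] (4 ℕ.* M ℕ.* G ℕ.≤ 2 ℕ.^ R × 2 ℕ.^ R ℕ.≤ 2 ℕ.* (4 ℕ.* M ℕ.* G)) → Parameters k m
  build (R , N≤ , ≤2N) = record
    { L = L ; R = R ; budget≤ = budget≤ ; k< = k<
    ; L≤R = 2^-cancel-≤ (ℕₚ.≤-trans (2^L≤M L budget≤) (ℕₚ.≤-trans M≤N N≤))
    ; deletions = ℕₚ.≤-trans (ℕₚ.*-mono-≤ 4m≤4M 1≤G) N≤
    ; deletions-L = ℕₚ.≤-trans (ℕₚ.*-mono-≤ 4m≤4M L≤G) N≤
    ; size = bound }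
    where
    open ℕₚ.≤-Reasoning
    -- Both `M` and `G` are at most `2 ^ G`, so `8MG` is at most `2 ^ (3 + 2G)`, and `3 ≤ 3G`.
    R≤5G : R ℕ.≤ 5 ℕ.* G
    R≤5G = ℕₚ.≤-trans (2^-cancel-≤ (begin
      2 ℕ.^ R                          ≤⟨ ≤2N ⟩
      2 ℕ.* (4 ℕ.* M ℕ.* G)            ≤⟨ ℕₚ.*-monoʳ-≤ 2 (ℕₚ.*-mono-≤ (ℕₚ.*-monoʳ-≤ 4 (n≤2^1+log M 1≤M)) (n≤2^n G)) ⟩
      2 ℕ.* (4 ℕ.* 2 ℕ.^ G ℕ.* 2 ℕ.^ G) ≡⟨ regroup (2 ℕ.^ G) ⟩
      2 ℕ.^ 3 ℕ.* (2 ℕ.^ G ℕ.* 2 ℕ.^ G) ≡⟨ cong (2 ℕ.^ 3 ℕ.*_) (ℕₚ.^-distribˡ-+-* 2 G G) ⟨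
      2 ℕ.^ 3 ℕ.* 2 ℕ.^ (G ℕ.+ G)      ≡⟨ ℕₚ.^-distribˡ-+-* 2 3 (G ℕ.+ G) ⟨
      2 ℕ.^ (3 ℕ.+ (G ℕ.+ G))          ∎)) (begin
      3 ℕ.+ (G ℕ.+ G)                  ≤⟨ ℕₚ.+-monoˡ-≤ (G ℕ.+ G) (ℕₚ.*-monoʳ-≤ 3 1≤G) ⟩
      3 ℕ.* G ℕ.+ (G ℕ.+ G)            ≡⟨ five G ⟩
      5 ℕ.* G                          ∎)
      where
      regroup : ∀ x → 2 ℕ.* (4 ℕ.* x ℕ.* x) ≡ 8 ℕ.* (x ℕ.* x)
      regroup = solve-∀
      five : ∀ x → 3 ℕ.* x ℕ.+ (x ℕ.+ x) ≡ 5 ℕ.* x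
      five = solve-∀
    M≤2S : M ℕ.≤ 2 ℕ.* S
    M≤2S = ℕₚ.≤-trans (ℕₚ.≤-reflexive (trans (sym (ℕₚ.+-assoc (k ℕ.+ m) 1 1)) (ℕₚ.+-comm S 1)))
      (ℕₚ.+-mono-≤ 1≤S (ℕₚ.≤-reflexive (sym (ℕₚ.+-identityʳ S))))
    expand : ∀ S G → G ℕ.* (G ℕ.* (5 ℕ.* G ℕ.* (2 ℕ.* (4 ℕ.* (2 ℕ.* S) ℕ.* G)))) ≡ 80 ℕ.* S ℕ.* (G ℕ.* (G ℕ.* (G ℕ.* (G ℕ.* 1))))
    expand = solve-∀
    collect : ∀ S X → S ℕ.* X ℕ.+ 80 ℕ.* S ℕ.* X ≡ 81 ℕ.* S ℕ.* X
    collect = solve-∀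
    -- The factor 5 from `R`, 8 from `2 ^ R` and 2 from `M ≤ 2S` make 80; the `suc m` singletons add
    -- one more `S`. The four powers of `G` come from `suc L`, `L`, `R` and `2 ^ R`.
    bound : suc m ℕ.+ suc L ℕ.* (L ℕ.* (R ℕ.* 2 ℕ.^ R)) ℕ.≤ 81 ℕ.* S ℕ.* G ℕ.^ 4
    bound = begin
      suc m ℕ.+ suc L ℕ.* (L ℕ.* (R ℕ.* 2 ℕ.^ R))
        ≤⟨ ℕₚ.+-mono-≤ (ℕₚ.≤-trans (ℕₚ.≤-reflexive (ℕₚ.+-comm 1 m)) (ℕₚ.+-monoˡ-≤ 1 (ℕₚ.m≤n+m m k)))
             (ℕₚ.*-mono-≤ L<G (ℕₚ.*-mono-≤ L≤G (ℕₚ.*-mono-≤ R≤5G ≤2N))) ⟩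
      S ℕ.+ G ℕ.* (G ℕ.* (5 ℕ.* G ℕ.* (2 ℕ.* (4 ℕ.* M ℕ.* G))))
        ≤⟨ ℕₚ.+-monoʳ-≤ S (ℕₚ.*-monoʳ-≤ G (ℕₚ.*-monoʳ-≤ G (ℕₚ.*-monoʳ-≤ (5 ℕ.* G) (ℕₚ.*-monoʳ-≤ 2 (ℕₚ.*-monoˡ-≤ G (ℕₚ.*-monoʳ-≤ 4 M≤2S)))))) ⟩
      S ℕ.+ G ℕ.* (G ℕ.* (5 ℕ.* G ℕ.* (2 ℕ.* (4 ℕ.* (2 ℕ.* S) ℕ.* G))))
        ≡⟨ cong (S ℕ.+_) (expand S G) ⟩
      S ℕ.+ 80 ℕ.* S ℕ.* G ℕ.^ 4
        ≤⟨ ℕₚ.+-monoˡ-≤ (80 ℕ.* S ℕ.* G ℕ.^ 4) (ℕₚ.m≤m*n S (G ℕ.^ 4) {{ℕ.>-nonZero (ℕₚ.m^n>0 G {{ℕ.>-nonZero 1≤G}} 4)}}) ⟩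
      S ℕ.* G ℕ.^ 4 ℕ.+ 80 ℕ.* S ℕ.* G ℕ.^ 4
        ≡⟨ collect S (G ℕ.^ 4) ⟩
      81 ℕ.* S ℕ.* G ℕ.^ 4 ∎

-- Subsets and additive costs

infixl 6 _∖_
_∖_ : Subset n → Subset n → Subset n
A ∖ B = A ∩ ∁ B

∈∖⁺ : ∀ {x} {A B : Subset n} → x ∈ A → x ∉ B → x ∈ A ∖ B
∈∖⁺ x∈A x∉B = x∈p∩q⁺ (x∈A , x∉p⇒x∈∁p x∉B)

∈∖⁻ : ∀ {x} (A B : Subset n) → x ∈ A ∖ B → x ∈ A × x ∉ B
∈∖⁻ A B x∈ with x∈p∩q⁻ A (∁ B) x∈
... | x∈A , x∈∁B = x∈A , x∈∁p⇒x∉p x∈∁B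

∖⊆ : ∀ (A B : Subset n) → A ∖ B ⊆ A
∖⊆ A B = p∩q⊆p A (∁ B)

∖-monoˡ : ∀ (A B C : Subset n) → A ⊆ B → A ∖ C ⊆ B ∖ C
∖-monoˡ A B C A⊆B x∈ with ∈∖⁻ A C x∈
... | x∈A , x∉C = ∈∖⁺ (A⊆B x∈A) x∉C

∪-lub : ∀ (A B : Subset n) {C} → A ⊆ C → B ⊆ C → A ∪ B ⊆ C
∪-lub A B A⊆C B⊆C x∈ with x∈p∪q⁻ A B x∈
... | inj₁ x∈A = A⊆C x∈A
... | inj₂ x∈B = B⊆C x∈B

⊆∪ˡ : ∀ (A B : Subset n) → A ⊆ A ∪ B
⊆∪ˡ A B = p⊆p∪q B

⊆∪ʳ : ∀ (A B : Subset n) → B ⊆ A ∪ B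
⊆∪ʳ A B = q⊆p∪q A B

∉∪ : ∀ {x} {A B : Subset n} → x ∉ A ∪ B → x ∉ A × x ∉ B
∉∪ {A = A} {B} x∉ = (λ x∈A → x∉ (⊆∪ˡ A B x∈A)) , (λ x∈B → x∉ (⊆∪ʳ A B x∈B))

⁅⁆⊆ : ∀ {x} {A : Subset n} → x ∈ A → ⁅ x ⁆ ⊆ A
⁅⁆⊆ {x = x} x∈A y∈ with x∈⁅y⁆⇒x≡y x y∈
... | refl = x∈A

∣∪∣≤ : ∀ (A B : Subset n) → ∣ A ∪ B ∣ ℕ.≤ ∣ A ∣ ℕ.+ ∣ B ∣
∣∪∣≤ []          []          = z≤n
∣∪∣≤ (true  ∷ A) (true  ∷ B) = s≤s (ℕₚ.≤-trans (∣∪∣≤ A B) (ℕₚ.+-monoʳ-≤ ∣ A ∣ (ℕₚ.n≤1+n ∣ B ∣)))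
∣∪∣≤ (true  ∷ A) (false ∷ B) = s≤s (∣∪∣≤ A B)
∣∪∣≤ (false ∷ A) (true  ∷ B) = ℕₚ.≤-trans (s≤s (∣∪∣≤ A B)) (ℕₚ.≤-reflexive (sym (ℕₚ.+-suc ∣ A ∣ ∣ B ∣)))
∣∪∣≤ (false ∷ A) (false ∷ B) = ∣∪∣≤ A B

subset-ind : (P : Subset n → Set) → P ⊥ → (∀ X e → e ∉ X → P X → P (X ∪ ⁅ e ⁆)) → ∀ X → P X
subset-ind P base step []          = base
subset-ind {suc n} P base step = λ where
    (false ∷ X) → outside-ind X
    (true  ∷ X) → subst (λ Y → P (true ∷ Y)) (∪-identityʳ X)
      (step (false ∷ X) F.zero (λ ()) (outside-ind X))
  where
  outside-ind : ∀ X → P (false ∷ X)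
  outside-ind = subset-ind (P ∘ (false ∷_)) base
    (λ Y e e∉ → step (false ∷ Y) (F.suc e) (e∉ ∘ drop-there))

argmax : ∀ {n} (g : Subset n → ℚ) {P : Subset n → Set} → (∀ X → Dec (P X)) →
         (∃[ Z ] (P Z × (∀ X → P X → g X ≤ g Z))) ⊎ (∀ X → ¬ P X)
argmax {zero} g P? with P? []
... | yes p  = inj₁ ([] , p , λ { [] _ → ≤-refl })
... | no ¬p  = inj₂ λ { [] → ¬p }
argmax {suc n} g P? with argmax (g ∘ (true ∷_)) (P? ∘ (true ∷_)) | argmax (g ∘ (false ∷_)) (P? ∘ (false ∷_))
... | inj₂ none₁ | inj₂ none₂ = inj₂ λ { (true ∷ X) → none₁ X ; (false ∷ X) → none₂ X }
... | inj₁ (Z , pZ , max) | inj₂ none =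
  inj₁ (true ∷ Z , pZ , λ { (true ∷ X) p → max X p ; (false ∷ X) p → contradiction p (none X) })
... | inj₂ none | inj₁ (Z , pZ , max) =
  inj₁ (false ∷ Z , pZ , λ { (false ∷ X) p → max X p ; (true ∷ X) p → contradiction p (none X) })
... | inj₁ (Z , pZ , max) | inj₁ (Z′ , pZ′ , max′) with ≤-total (g (true ∷ Z)) (g (false ∷ Z′))
...   | inj₁ Z≤Z′ = inj₁ (false ∷ Z′ , pZ′ ,
          λ { (true ∷ X) p → ≤-trans (max X p) Z≤Z′ ; (false ∷ X) p → max′ X p })
...   | inj₂ Z′≤Z = inj₁ (true ∷ Z , pZ ,
          λ { (true ∷ X) p → max X p ; (false ∷ X) p → ≤-trans (max′ X p) Z′≤Z })

cost-⊥ : ∀ {n} (c : Fin n → ℚ) → cost c ⊥ ≡ 0ℚ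
cost-⊥ {zero}  c = refl
cost-⊥ {suc n} c = cost-⊥ (c ∘ F.suc)

cost-insert : ∀ {n} (c : Fin n → ℚ) X e → e ∉ X → cost c (X ∪ ⁅ e ⁆) ≡ cost c X + c e
cost-insert c (true  ∷ X) F.zero    e∉ = contradiction here e∉
cost-insert c (false ∷ X) F.zero    e∉ =
  trans (cong (λ Y → c F.zero + cost (c ∘ F.suc) Y) (∪-identityʳ X)) (+-comm (c F.zero) _)
cost-insert c (true  ∷ X) (F.suc e) e∉ =
  trans (cong (c F.zero +_) (cost-insert (c ∘ F.suc) X e (e∉ ∘ there)))
        (sym (+-assoc (c F.zero) _ _))
cost-insert c (false ∷ X) (F.suc e) e∉ = cost-insert (c ∘ F.suc) X e (e∉ ∘ there)

cost-⁅⁆ : ∀ (c : Fin n → ℚ) e → cost c ⁅ e ⁆ ≡ c e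
cost-⁅⁆ c e = begin
  cost c ⁅ e ⁆        ≡⟨ cong (cost c) (∪-identityˡ ⁅ e ⁆) ⟨
  cost c (⊥ ∪ ⁅ e ⁆)  ≡⟨ cost-insert c ⊥ e ∉⊥ ⟩
  cost c ⊥ + c e      ≡⟨ cong (_+ c e) (cost-⊥ c) ⟩
  0ℚ + c e            ≡⟨ +-identityˡ (c e) ⟩
  c e                 ∎
  where open ≡-Reasoning

cost-split : ∀ {n} (c : Fin n → ℚ) X E → cost c X ≡ cost c (X ∩ E) + cost c (X ∖ E)
cost-split c []          []          = refl
cost-split c (false ∷ X) (_     ∷ E) = cost-split (c ∘ F.suc) X E
cost-split c (true  ∷ X) (true  ∷ E) =
  trans (cong (c F.zero +_) (cost-split (c ∘ F.suc) X E)) (sym (+-assoc (c F.zero) _ _))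
cost-split c (true  ∷ X) (false ∷ E) =
  trans (cong (c F.zero +_) (cost-split (c ∘ F.suc) X E))
    (solve 3 (λ x y z → x :+ (y :+ z) := y :+ (x :+ z)) refl
      (c F.zero) (cost (c ∘ F.suc) (X ∩ E)) (cost (c ∘ F.suc) (X ∖ E)))

cost-mod : ∀ {n} (c : Fin n → ℚ) X Y → cost c (X ∪ Y) + cost c (X ∩ Y) ≡ cost c X + cost c Y
cost-mod c []          []          = refl
cost-mod c (true  ∷ X) (true  ∷ Y) = begin
  (x + u) + (x + i)  ≡⟨ solve 3 (λ x u i → (x :+ u) :+ (x :+ i) := (x :+ x) :+ (u :+ i)) refl x u i ⟩
  (x + x) + (u + i)  ≡⟨ cong ((x + x) +_) (cost-mod (c ∘ F.suc) X Y) ⟩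
  (x + x) + (v + w)  ≡⟨ solve 3 (λ x v w → (x :+ x) :+ (v :+ w) := (x :+ v) :+ (x :+ w)) refl x v w ⟩
  (x + v) + (x + w)  ∎
  where
  open ≡-Reasoning
  x = c F.zero
  u = cost (c ∘ F.suc) (X ∪ Y)
  i = cost (c ∘ F.suc) (X ∩ Y)
  v = cost (c ∘ F.suc) X
  w = cost (c ∘ F.suc) Y
cost-mod c (true  ∷ X) (false ∷ Y) =
  trans (+-assoc (c F.zero) _ _) (trans (cong (c F.zero +_) (cost-mod (c ∘ F.suc) X Y)) (sym (+-assoc (c F.zero) _ _)))
cost-mod c (false ∷ X) (true  ∷ Y) =
  trans (+-assoc (c F.zero) _ _) (trans (cong (c F.zero +_) (cost-mod (c ∘ F.suc) X Y))
    (solve 3 (λ x y z → x :+ (y :+ z) := y :+ (x :+ z)) refl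
      (c F.zero) (cost (c ∘ F.suc) X) (cost (c ∘ F.suc) Y)))
cost-mod c (false ∷ X) (false ∷ Y) = cost-mod (c ∘ F.suc) X Y

cost-one : ∀ {n} (X : Subset n) → cost (λ _ → 1ℚ) X ≡ ι ∣ X ∣
cost-one []          = refl
cost-one (true  ∷ X) = cong (1ℚ +_) (cost-one X)
cost-one (false ∷ X) = cost-one X

module _ {n : ℕ} {c : Fin n → ℚ} (0≤c : ∀ e → 0ℚ ≤ c e) where

  cost-nonNeg : ∀ X → 0ℚ ≤ cost c X
  cost-nonNeg = subset-ind (λ X → 0ℚ ≤ cost c X) (≤-reflexive (sym (cost-⊥ c)))
    (λ X e e∉X 0≤cX → subst (0ℚ ≤_) (sym (cost-insert c X e e∉X)) (+-mono-≤ 0≤cX (0≤c e)))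

  cost-mono : ∀ {X Y} → X ⊆ Y → cost c X ≤ cost c Y
  cost-mono {X} {Y} X⊆Y = begin
    cost c X                      ≡⟨ cong (cost c) (⊆-antisym (λ x∈ → x∈p∩q⁺ (X⊆Y x∈ , x∈)) (p∩q⊆q Y X)) ⟩
    cost c (Y ∩ X)                ≡⟨ +-identityʳ _ ⟨
    cost c (Y ∩ X) + 0ℚ           ≤⟨ +-monoʳ-≤ (cost c (Y ∩ X)) (cost-nonNeg (Y ∖ X)) ⟩
    cost c (Y ∩ X) + cost c (Y ∖ X) ≡⟨ cost-split c Y X ⟨
    cost c Y                      ∎
    where open ≤-Reasoning

  cost-subadd : ∀ X Y → cost c (X ∪ Y) ≤ cost c X + cost c Y
  cost-subadd X Y = by (cost-nonNeg (X ∩ Y)) (trans (cost-mod c X Y) (sym (+-identityʳ _)))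

  -- For disjoint sets the intersection term of the modular identity vanishes. With unit costs this
  -- adds up the deletions in separate branches of a tree.
  cost-superadd : ∀ X Y E → (∀ {x} → x ∈ X → x ∉ Y) →
                  cost c (X ∩ E) + cost c (Y ∩ E) ≤ cost c ((X ∪ Y) ∩ E)
  cost-superadd X Y E disj = begin
    cost c (X ∩ E) + cost c (Y ∩ E)              ≡⟨ cost-mod c (X ∩ E) (Y ∩ E) ⟨
    cost c ((X ∩ E) ∪ (Y ∩ E)) + cost c ((X ∩ E) ∩ (Y ∩ E))
      ≡⟨ cong (cost c ((X ∩ E) ∪ (Y ∩ E)) +_) (trans (cong (cost c) empty) (cost-⊥ c)) ⟩
    cost c ((X ∩ E) ∪ (Y ∩ E)) + 0ℚ              ≡⟨ +-identityʳ _ ⟩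
    cost c ((X ∩ E) ∪ (Y ∩ E))                   ≡⟨ cong (cost c) (∩-distribʳ-∪ E X Y) ⟨
    cost c ((X ∪ Y) ∩ E)                         ∎
    where
    open ≤-Reasoning
    empty : (X ∩ E) ∩ (Y ∩ E) ≡ ⊥
    empty = Empty-unique λ (x , x∈) →
      let x∈₁ , x∈₂ = x∈p∩q⁻ (X ∩ E) (Y ∩ E) x∈ in disj (p∩q⊆p X E x∈₁) (p∩q⊆p Y E x∈₂)

-- Filters, finite unions and best elements

filter : {P : Fin n → Set} → (∀ e → Dec (P e)) → Subset n
filter P? = tabulate (does ∘ P?)

∈filter⁺ : ∀ {P : Fin n → Set} (P? : ∀ e → Dec (P e)) {e} → P e → e ∈ filter P?
∈filter⁺ P? {e} p = lookup⇒[]= e _ (trans (lookup∘tabulate (does ∘ P?) e) (dec-true (P? e) p))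

∈filter⁻ : ∀ {P : Fin n → Set} (P? : ∀ e → Dec (P e)) {e} → e ∈ filter P? → P e
∈filter⁻ P? {e} e∈ with P? e | trans (sym (lookup∘tabulate (does ∘ P?) e)) ([]=⇒lookup e∈)
... | yes p | _  = p
... | no  _ | ()

cost-∈ : ∀ {c : Fin n → ℚ} → (∀ e → 0ℚ ≤ c e) → ∀ {X e} → e ∈ X → c e ≤ cost c X
cost-∈ {c = c} 0≤c {X} {e} e∈X = ≤-trans (≤-reflexive (sym (cost-⁅⁆ c e))) (cost-mono 0≤c (⁅⁆⊆ e∈X))

⋃< : ℕ → (ℕ → Subset n) → Subset n
⋃< zero    S = ⊥
⋃< (suc t) S = ⋃< t S ∪ S t

⊆⋃< : ∀ (S : ℕ → Subset n) {s t} → s ℕ.< t → S s ⊆ ⋃< t S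
⊆⋃< S {s} {suc t} (s≤s s≤t) with ℕₚ.m≤n⇒m<n∨m≡n s≤t
... | inj₁ s<t  = ⊆∪ˡ (⋃< t S) (S t) ∘ ⊆⋃< S s<t
... | inj₂ refl = ⊆∪ʳ (⋃< t S) (S t)

∣⋃<∣≤ : ∀ (S : ℕ → Subset n) {B} → (∀ s → ∣ S s ∣ ℕ.≤ B) → ∀ t → ∣ ⋃< t S ∣ ℕ.≤ t ℕ.* B
∣⋃<∣≤ {n} S ≤B zero = ℕₚ.≤-reflexive (∣⊥∣≡0 n)
∣⋃<∣≤ S {B} ≤B (suc t) = ℕₚ.≤-trans (∣∪∣≤ (⋃< t S) (S t))
  (ℕₚ.≤-trans (ℕₚ.≤-reflexive (ℕₚ.+-comm ∣ ⋃< t S ∣ ∣ S t ∣)) (ℕₚ.+-mono-≤ (≤B t) (∣⋃<∣≤ S ≤B t)))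

∣>∣⇒survivor : ∀ (T E : Subset n) → ∣ E ∣ ℕ.< ∣ T ∣ → ∃[ x ] (x ∈ T × x ∉ E)
∣>∣⇒survivor T E E<T with any? (λ x → (x ∈? T) ×-dec ¬? (x ∈? E))
... | yes found = found
... | no  none  = contradiction (ℕₚ.<-≤-trans E<T (p⊆q⇒∣p∣≤∣q∣ T⊆E)) (ℕₚ.<-irrefl refl)
  where
  T⊆E : T ⊆ E
  T⊆E {x} x∈T with x ∈? E
  ... | yes x∈E = x∈E
  ... | no  x∉E = contradiction (x , x∈T , x∉E) none

best-element : (g : Subset n → ℚ) (A : Subset n) →
               (∃[ e ] (e ∈ A × (∀ x → x ∈ A → g ⁅ x ⁆ ≤ g ⁅ e ⁆))) ⊎ (∀ x → x ∉ A)
best-element g A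
  with argmax g {λ X → ∃[ e ] (e ∈ A × X ≡ ⁅ e ⁆)} (λ X → any? (λ e → (e ∈? A) ×-dec ≡-dec _≟ᵇ_ X ⁅ e ⁆))
... | inj₁ (_ , (e , e∈A , refl) , max) = inj₁ (e , e∈A , λ x x∈A → max ⁅ x ⁆ (x , x∈A , refl))
... | inj₂ none                         = inj₂ (λ x x∈A → none ⁅ x ⁆ (x , x∈A , refl))

empty-∖ : ∀ (A B : Subset n) → (∀ x → x ∉ A ∖ B) → A ⊆ B
empty-∖ A B empty {x} x∈A with x ∈? B
... | yes x∈B = x∈B
... | no  x∉B = contradiction (∈∖⁺ x∈A x∉B) (empty x)

-- The best remaining element is taken `r` times. Each new element dominates what is left by its
-- choice, the earlier ones by induction; if the elements run out first, all of `A` has been taken.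
top : (g : Subset n → ℚ) (A : Subset n) → ∀ r →
      ∃[ T ] (T ⊆ A × ∣ T ∣ ℕ.≤ r ×
        (A ⊆ T ⊎ (r ℕ.≤ ∣ T ∣ × (∀ x e → x ∈ T → e ∈ A ∖ T → g ⁅ e ⁆ ≤ g ⁅ x ⁆))))
top {n} g A zero = ⊥ , ⊆-min A , ℕₚ.≤-reflexive (∣⊥∣≡0 n) , inj₂ (z≤n , λ x e x∈⊥ → contradiction x∈⊥ ∉⊥)
top g A (suc r) with top g A r
... | T , T⊆A , ∣T∣≤r , inj₁ A⊆T = T , T⊆A , ℕₚ.m≤n⇒m≤1+n ∣T∣≤r , inj₁ A⊆T
... | T , T⊆A , ∣T∣≤r , inj₂ (r≤∣T∣ , above) with best-element g (A ∖ T)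
...   | inj₂ empty = T , T⊆A , ℕₚ.m≤n⇒m≤1+n ∣T∣≤r , inj₁ (empty-∖ A T empty)
...   | inj₁ (e , e∈ , max) = T ∪ ⁅ e ⁆ , ∪-lub T ⁅ e ⁆ T⊆A (⁅⁆⊆ (∖⊆ A T e∈)) ,
  ℕₚ.≤-trans (∣∪∣≤ T ⁅ e ⁆) (ℕₚ.≤-trans (ℕₚ.+-mono-≤ ∣T∣≤r (ℕₚ.≤-reflexive (∣⁅x⁆∣≡1 e))) (ℕₚ.≤-reflexive (ℕₚ.+-comm r 1))) ,
  inj₂ (ℕₚ.≤-<-trans r≤∣T∣ (p⊂q⇒∣p∣<∣q∣ {p = T} (⊆∪ˡ T ⁅ e ⁆ , e , ⊆∪ʳ T ⁅ e ⁆ (x∈⁅x⁆ e) , proj₂ (∈∖⁻ A T e∈))) , above′)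
  where
  above′ : ∀ x y → x ∈ T ∪ ⁅ e ⁆ → y ∈ A ∖ (T ∪ ⁅ e ⁆) → g ⁅ y ⁆ ≤ g ⁅ x ⁆
  above′ x y x∈ y∈ with ∈∖⁻ A (T ∪ ⁅ e ⁆) y∈ | x∈p∪q⁻ T ⁅ e ⁆ x∈
  ... | y∈A , y∉ | inj₁ x∈T = above x y x∈T (∈∖⁺ y∈A (proj₁ (∉∪ y∉)))
  ... | y∈A , y∉ | inj₂ x∈e with x∈⁅y⁆⇒x≡y e x∈e
  ...   | refl = max y (∈∖⁺ y∈A (proj₁ (∉∪ y∉)))

-- Submodular functions

module _ {n : ℕ} {f : Subset n → ℚ} (0≤f : NonNegative f) (mono : Monotone f) (submod : Submodular f) where

  gain-antitone : ∀ {A B} e → A ⊆ B → f (B ∪ ⁅ e ⁆) + f A ≤ f (A ∪ ⁅ e ⁆) + f B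
  gain-antitone {A} {B} e A⊆B = by (submod A B e A⊆B)
    (solve 4 (λ b′ b a′ a → (b′ :+ a) :+ (a′ :- a) := (a′ :+ b) :+ (b′ :- b)) refl
      (f (B ∪ ⁅ e ⁆)) (f B) (f (A ∪ ⁅ e ⁆)) (f A))

  -- When `X` is added one element at a time, each gain over the larger set is at most the one over
  -- the smaller set, and the gains telescope.
  gain-antitone-∪ : ∀ {A B} → A ⊆ B → ∀ X → f (B ∪ X) + f A ≤ f (A ∪ X) + f B
  gain-antitone-∪ {A} {B} A⊆B = subset-ind _ base step
    where
    base : f (B ∪ ⊥) + f A ≤ f (A ∪ ⊥) + f B
    base rewrite ∪-identityʳ A | ∪-identityʳ B = ≤-reflexive (+-comm (f B) (f A))
    step : ∀ X e → e ∉ X → f (B ∪ X) + f A ≤ f (A ∪ X) + f B →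
           f (B ∪ (X ∪ ⁅ e ⁆)) + f A ≤ f (A ∪ (X ∪ ⁅ e ⁆)) + f B
    step X e _ ih rewrite sym (∪-assoc A X ⁅ e ⁆) | sym (∪-assoc B X ⁅ e ⁆) =
      by (ih ⊕ gain-antitone e A∪X⊆B∪X)
        (solve 6 (λ b a bx ax bxe axe →
            (bxe :+ a) :+ ((ax :+ b) :+ (axe :+ bx)) := (axe :+ b) :+ ((bx :+ a) :+ (bxe :+ ax))) refl
          (f B) (f A) (f (B ∪ X)) (f (A ∪ X)) (f ((B ∪ X) ∪ ⁅ e ⁆)) (f ((A ∪ X) ∪ ⁅ e ⁆)))
      where
      A∪X⊆B∪X : A ∪ X ⊆ B ∪ X
      A∪X⊆B∪X = ∪-lub A X (⊆∪ˡ B X ∘ A⊆B) (⊆∪ʳ B X)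

  -- The gain of `Y` over `X` is at most its gain over the empty set, whose value is nonnegative.
  subadditive : ∀ X Y → f (X ∪ Y) ≤ f X + f Y
  subadditive X Y = by (gain-antitone-∪ {⊥} {X} (⊆-min X) Y ⊕ 0≤f ⊥)
    (trans (cong (λ Z → f (X ∪ Y) + ((f Z + f X) + f ⊥)) (∪-identityˡ Y))
      (solve 4 (λ xy x y o → xy :+ ((y :+ x) :+ o) := (x :+ y) :+ ((xy :+ o) :+ con 0ℚ)) refl
        (f (X ∪ Y)) (f X) (f Y) (f ⊥)))

  -- Over `U` and the part of `X` already added, an element gains no more than over `U` alone, so
  -- the bounds for single elements add up.
  gain-bound-∪ : ∀ (c : Fin n → ℚ) θ U X → (∀ e → e ∈ X → f (U ∪ ⁅ e ⁆) ≤ f U + θ * c e) →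
                 f (U ∪ X) ≤ f U + θ * cost c X
  gain-bound-∪ c θ U = subset-ind _ base step
    where
    base : (∀ e → e ∈ ⊥ → f (U ∪ ⁅ e ⁆) ≤ f U + θ * c e) → f (U ∪ ⊥) ≤ f U + θ * cost c ⊥
    base _ rewrite ∪-identityʳ U | cost-⊥ c | *-zeroʳ θ | +-identityʳ (f U) = ≤-refl
    step : ∀ X e → e ∉ X →
           ((∀ e → e ∈ X → f (U ∪ ⁅ e ⁆) ≤ f U + θ * c e) → f (U ∪ X) ≤ f U + θ * cost c X) →
           (∀ x → x ∈ X ∪ ⁅ e ⁆ → f (U ∪ ⁅ x ⁆) ≤ f U + θ * c x) →
           f (U ∪ (X ∪ ⁅ e ⁆)) ≤ f U + θ * cost c (X ∪ ⁅ e ⁆)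
    step X e e∉X ih small rewrite cost-insert c X e e∉X | sym (∪-assoc U X ⁅ e ⁆) =
      by (ih (λ x x∈ → small x (⊆∪ˡ X ⁅ e ⁆ x∈)) ⊕ small e (⊆∪ʳ X ⁅ e ⁆ (x∈⁅x⁆ e))
           ⊕ gain-antitone e (⊆∪ˡ U X))
        (solve 7 (λ u uxe ux ue t cX ce →
            uxe :+ (((u :+ t :* cX) :+ (u :+ t :* ce)) :+ (ue :+ ux))
              := (u :+ t :* (cX :+ ce)) :+ ((ux :+ ue) :+ (uxe :+ u))) refl
          (f U) (f ((U ∪ X) ∪ ⁅ e ⁆)) (f (U ∪ X)) (f (U ∪ ⁅ e ⁆)) θ (cost c X) (c e))

  count : Subset n → ℚ
  count = cost (λ _ → 1ℚ)

  -- The binary tree of greedy paths at one density threshold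

  module Tree {c : Fin n → ℚ} (0≤c : ∀ e → 0ℚ ≤ c e) (θ cap : ℚ) (0≤θ : 0ℚ ≤ θ) where

    -- Quantified over the deleted set because the value of a path is needed after the deletions.
    Dense : Subset n → Set
    Dense Q = ∀ E → θ * cost c (Q ∖ E) ≤ f (Q ∖ E)

    Rejects : ℚ → Subset n → Subset n → Set
    Rejects b Q W = ∀ e → e ∈ W → c e < b → f (Q ∪ ⁅ e ⁆) ≤ f Q + θ * c e

    Outcome : Subset n → Subset n → Set
    Outcome Q W = Dense Q × cost c Q < cap + cap × (cap ≤ cost c Q ⊎ Rejects cap Q W)

    -- ℓ is the cost that the path Q chosen after the deletions loses per deleted element of 𝒮.
    Extension : Subset n → Subset n → ℕ → ℚ → Set
    Extension P W s ℓ = ∃[ 𝒮 ] (𝒮 ⊆ W × ∣ 𝒮 ∣ ℕ.≤ s × (∀ E →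
      ∃[ Q ] (Q ⊆ P ∪ 𝒮 × Outcome Q (W ∖ 𝒮) ×
        cost c (Q ∩ E) ≤ cost c (P ∩ E) + ℓ * count (𝒮 ∩ E))))

    -- Marginal values only fall as the path grows, so a rejected element stays rejected.
    rejects-⊆ : ∀ {b P Q V W} → P ⊆ Q → V ⊆ W → Rejects b P W → Rejects b Q V
    rejects-⊆ {P = P} {Q} P⊆Q V⊆W rej e e∈V ce<b = by (gain-antitone e P⊆Q ⊕ rej e (V⊆W e∈V) ce<b)
      (solve 5 (λ qe p pe q t → qe :+ ((pe :+ q) :+ (p :+ t)) := (q :+ t) :+ ((qe :+ p) :+ pe)) refl
        (f (Q ∪ ⁅ e ⁆)) (f P) (f (P ∪ ⁅ e ⁆)) (f Q) (θ * c e))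

    outcome-⊆ : ∀ {Q V W} → V ⊆ W → Outcome Q W → Outcome Q V
    outcome-⊆ V⊆W (dense , small , inj₁ full) = dense , small , inj₁ full
    outcome-⊆ V⊆W (dense , small , inj₂ rej)  = dense , small , inj₂ (rejects-⊆ (λ x → x) V⊆W rej)

    count-nonNeg : ∀ X → 0ℚ ≤ count X
    count-nonNeg = cost-nonNeg (λ _ → 0≤1)

    -- If `e` is deleted, the survivors are those of `P`. If it survives, its marginal value over
    -- the surviving part of `P` is at least that over `P`, hence at least `θ * c e`.
    dense-insert : ∀ {P e} → e ∉ P → f P + θ * c e ≤ f (P ∪ ⁅ e ⁆) → Dense P → Dense (P ∪ ⁅ e ⁆)
    dense-insert {P} {e} e∉P gain dense E with e ∈? E
    ... | yes e∈E = begin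
      θ * cost c ((P ∪ ⁅ e ⁆) ∖ E)  ≤⟨ *-monoˡ 0≤θ (cost-mono 0≤c ⊆P∖E) ⟩
      θ * cost c (P ∖ E)            ≤⟨ dense E ⟩
      f (P ∖ E)                     ≤⟨ mono _ _ (∖-monoˡ P (P ∪ ⁅ e ⁆) E (⊆∪ˡ P ⁅ e ⁆)) ⟩
      f ((P ∪ ⁅ e ⁆) ∖ E)           ∎
      where
      open ≤-Reasoning
      ⊆P∖E : (P ∪ ⁅ e ⁆) ∖ E ⊆ P ∖ E
      ⊆P∖E x∈ with ∈∖⁻ (P ∪ ⁅ e ⁆) E x∈
      ... | x∈∪ , x∉E with x∈p∪q⁻ P ⁅ e ⁆ x∈∪
      ...   | inj₁ x∈P = ∈∖⁺ x∈P x∉E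
      ...   | inj₂ x∈e with x∈⁅y⁆⇒x≡y e x∈e
      ...     | refl = contradiction e∈E x∉E
    ... | no e∉E = begin
      θ * cost c ((P ∪ ⁅ e ⁆) ∖ E)   ≤⟨ *-monoˡ 0≤θ (cost-mono 0≤c ⊆insert) ⟩
      θ * cost c ((P ∖ E) ∪ ⁅ e ⁆)   ≡⟨ cong (θ *_) (cost-insert c (P ∖ E) e (e∉P ∘ ∖⊆ P E)) ⟩
      θ * (cost c (P ∖ E) + c e)     ≤⟨ by (dense E ⊕ gain ⊕ gain-antitone e (∖⊆ P E))
          (solve 7 (λ t x y d p pe de →
             t :* (x :+ y) :+ ((d :+ pe) :+ (de :+ p)) := de :+ ((t :* x :+ (p :+ t :* y)) :+ (pe :+ d))) refl
            θ (cost c (P ∖ E)) (c e) (f (P ∖ E)) (f P) (f (P ∪ ⁅ e ⁆)) (f ((P ∖ E) ∪ ⁅ e ⁆))) ⟩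
      f ((P ∖ E) ∪ ⁅ e ⁆)            ≤⟨ mono _ _ insert⊆ ⟩
      f ((P ∪ ⁅ e ⁆) ∖ E)            ∎
      where
      open ≤-Reasoning
      ⊆insert : (P ∪ ⁅ e ⁆) ∖ E ⊆ (P ∖ E) ∪ ⁅ e ⁆
      ⊆insert x∈ with ∈∖⁻ (P ∪ ⁅ e ⁆) E x∈
      ... | x∈∪ , x∉E with x∈p∪q⁻ P ⁅ e ⁆ x∈∪
      ...   | inj₁ x∈P = ⊆∪ˡ (P ∖ E) ⁅ e ⁆ (∈∖⁺ x∈P x∉E)
      ...   | inj₂ x∈e = ⊆∪ʳ (P ∖ E) ⁅ e ⁆ x∈e
      insert⊆ : (P ∖ E) ∪ ⁅ e ⁆ ⊆ (P ∪ ⁅ e ⁆) ∖ E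
      insert⊆ = ∪-lub (P ∖ E) ⁅ e ⁆ (∖-monoˡ P (P ∪ ⁅ e ⁆) E (⊆∪ˡ P ⁅ e ⁆))
                  (⁅⁆⊆ (∈∖⁺ (⊆∪ʳ P ⁅ e ⁆ (x∈⁅x⁆ e)) e∉E))

    stop : ∀ {P W s ℓ} → 0ℚ ≤ ℓ → Outcome P W → Extension P W s ℓ
    stop {P} {W} {ℓ = ℓ} 0≤ℓ out = ⊥ , ⊆-min W , subst (ℕ._≤ _) (sym (∣⊥∣≡0 n)) z≤n , λ E →
      P , ⊆∪ˡ P ⊥ , outcome-⊆ (∖⊆ W ⊥) out ,
      by (*-nonNeg 0≤ℓ (count-nonNeg (⊥ ∩ E)))
         (solve 2 (λ x y → x :+ y := (x :+ y) :+ con 0ℚ) refl (cost c (P ∩ E)) (ℓ * count (⊥ ∩ E)))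

    -- One of two disjoint extensions suffers at most half of the deletions.
    double : ∀ {P W s ℓ} → 0ℚ ≤ ℓ → (∀ V → V ⊆ W → Extension P V s (ℓ + ℓ)) → Extension P W (s ℕ.+ s) ℓ
    double {P} {W} {s} {ℓ} 0≤ℓ ext with ext W (λ x → x)
    ... | S₁ , S₁⊆W , ∣S₁∣≤s , path₁ with ext (W ∖ S₁) (∖⊆ W S₁)
    ...   | S₂ , S₂⊆W , ∣S₂∣≤s , path₂ =
      S₁ ∪ S₂ , ∪-lub S₁ S₂ S₁⊆W (∖⊆ W S₁ ∘ S₂⊆W) ,
      ℕₚ.≤-trans (∣∪∣≤ S₁ S₂) (ℕₚ.+-mono-≤ ∣S₁∣≤s ∣S₂∣≤s) , choose
      where
      disjoint : ∀ E → count (S₁ ∩ E) + count (S₂ ∩ E) ≤ count ((S₁ ∪ S₂) ∩ E)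
      disjoint E = cost-superadd (λ _ → 0≤1) S₁ S₂ E (λ x∈S₁ x∈S₂ → proj₂ (∈∖⁻ W S₁ (S₂⊆W x∈S₂)) x∈S₁)
      remaining₁ : W ∖ (S₁ ∪ S₂) ⊆ W ∖ S₁
      remaining₁ x∈ with ∈∖⁻ W (S₁ ∪ S₂) x∈
      ... | x∈W , x∉ = ∈∖⁺ x∈W (proj₁ (∉∪ x∉))
      remaining₂ : W ∖ (S₁ ∪ S₂) ⊆ W ∖ S₁ ∖ S₂
      remaining₂ x∈ = ∈∖⁺ (remaining₁ x∈) (proj₂ (∉∪ (proj₂ (∈∖⁻ W (S₁ ∪ S₂) x∈))))
      choose : ∀ E → ∃[ Q ] (Q ⊆ P ∪ (S₁ ∪ S₂) × Outcome Q (W ∖ (S₁ ∪ S₂)) ×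
        cost c (Q ∩ E) ≤ cost c (P ∩ E) + ℓ * count ((S₁ ∪ S₂) ∩ E))
      choose E with ≤-total (count (S₁ ∩ E)) (count (S₂ ∩ E)) | path₁ E | path₂ E
      ... | inj₁ x≤y | Q , Q⊆ , out , loss | _ =
        Q , ∪-lub P S₁ (⊆∪ˡ P (S₁ ∪ S₂)) (⊆∪ʳ P (S₁ ∪ S₂) ∘ ⊆∪ˡ S₁ S₂) ∘ Q⊆ , outcome-⊆ remaining₁ out ,
        by (loss ⊕ *-monoˡ 0≤ℓ x≤y ⊕ *-monoˡ 0≤ℓ (disjoint E))
          (solve 6 (λ q p l x y z →
             q :+ (((p :+ (l :+ l) :* x) :+ l :* y) :+ l :* z) := (p :+ l :* z) :+ ((q :+ l :* x) :+ l :* (x :+ y))) refl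
            (cost c (Q ∩ E)) (cost c (P ∩ E)) ℓ (count (S₁ ∩ E)) (count (S₂ ∩ E)) (count ((S₁ ∪ S₂) ∩ E)))
      ... | inj₂ y≤x | _ | Q , Q⊆ , out , loss =
        Q , ∪-lub P S₂ (⊆∪ˡ P (S₁ ∪ S₂)) (⊆∪ʳ P (S₁ ∪ S₂) ∘ ⊆∪ʳ S₁ S₂) ∘ Q⊆ , outcome-⊆ remaining₂ out ,
        by (loss ⊕ *-monoˡ 0≤ℓ y≤x ⊕ *-monoˡ 0≤ℓ (disjoint E))
          (solve 6 (λ q p l x y z →
             q :+ (((p :+ (l :+ l) :* y) :+ l :* x) :+ l :* z) := (p :+ l :* z) :+ ((q :+ l :* y) :+ l :* (x :+ y))) refl
            (cost c (Q ∩ E)) (cost c (P ∩ E)) ℓ (count (S₁ ∩ E)) (count (S₂ ∩ E)) (count ((S₁ ∪ S₂) ∩ E)))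

    -- The new element joins both the path and the summary. As it costs at most `ℓ`, its own
    -- deletion respects the loss rate `ℓ` per deleted element.
    insert : ∀ {P W e s ℓ} → 0ℚ ≤ ℓ → e ∈ W → e ∉ P → c e ≤ ℓ →
             Extension (P ∪ ⁅ e ⁆) (W ∖ ⁅ e ⁆) s ℓ → Extension P W (suc s) ℓ
    insert {P} {W} {e} {s} {ℓ} 0≤ℓ e∈W e∉P ce≤ℓ (S , S⊆ , ∣S∣≤s , path) =
      ⁅ e ⁆ ∪ S , ∪-lub ⁅ e ⁆ S (⁅⁆⊆ e∈W) (∖⊆ W ⁅ e ⁆ ∘ S⊆) ,
      ℕₚ.≤-trans (∣∪∣≤ ⁅ e ⁆ S) (ℕₚ.+-mono-≤ (ℕₚ.≤-reflexive (∣⁅x⁆∣≡1 e)) ∣S∣≤s) , extend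
      where
      remaining : W ∖ (⁅ e ⁆ ∪ S) ⊆ W ∖ ⁅ e ⁆ ∖ S
      remaining x∈ with ∈∖⁻ W (⁅ e ⁆ ∪ S) x∈
      ... | x∈W , x∉ = ∈∖⁺ (∈∖⁺ x∈W (proj₁ (∉∪ x∉))) (proj₂ (∉∪ x∉))
      disjoint : ∀ E → count (⁅ e ⁆ ∩ E) + count (S ∩ E) ≤ count ((⁅ e ⁆ ∪ S) ∩ E)
      disjoint E = cost-superadd (λ _ → 0≤1) ⁅ e ⁆ S E (λ x∈e x∈S → proj₂ (∈∖⁻ W ⁅ e ⁆ (S⊆ x∈S)) x∈e)
      single : ∀ E → cost c ((P ∪ ⁅ e ⁆) ∩ E) ≤ cost c (P ∩ E) + ℓ * count (⁅ e ⁆ ∩ E)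
      single E rewrite ∩-distribʳ-∪ E P ⁅ e ⁆ = begin
        cost c ((P ∩ E) ∪ (⁅ e ⁆ ∩ E))            ≤⟨ cost-subadd 0≤c (P ∩ E) (⁅ e ⁆ ∩ E) ⟩
        cost c (P ∩ E) + cost c (⁅ e ⁆ ∩ E)       ≤⟨ +-monoʳ-≤ (cost c (P ∩ E)) part ⟩
        cost c (P ∩ E) + ℓ * count (⁅ e ⁆ ∩ E)    ∎
        where
        open ≤-Reasoning
        part : cost c (⁅ e ⁆ ∩ E) ≤ ℓ * count (⁅ e ⁆ ∩ E)
        part with e ∈? E
        ... | yes e∈E rewrite ⊆-antisym (p∩q⊆p ⁅ e ⁆ E) (⁅⁆⊆ {A = ⁅ e ⁆ ∩ E} (x∈p∩q⁺ (x∈⁅x⁆ e , e∈E)))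
          | cost-⁅⁆ c e | cost-⁅⁆ (λ _ → 1ℚ) e | *-identityʳ ℓ = ce≤ℓ
        ... | no e∉E = begin
          cost c (⁅ e ⁆ ∩ E)       ≤⟨ cost-mono 0≤c empty ⟩
          cost c ⊥                 ≡⟨ cost-⊥ c ⟩
          0ℚ                       ≤⟨ *-nonNeg 0≤ℓ (count-nonNeg (⁅ e ⁆ ∩ E)) ⟩
          ℓ * count (⁅ e ⁆ ∩ E)    ∎
          where
          empty : ⁅ e ⁆ ∩ E ⊆ ⊥
          empty x∈ with x∈p∩q⁻ ⁅ e ⁆ E x∈
          ... | x∈e , x∈E with x∈⁅y⁆⇒x≡y e x∈e
          ...   | refl = contradiction x∈E e∉E
      extend : ∀ E → ∃[ Q ] (Q ⊆ P ∪ (⁅ e ⁆ ∪ S) × Outcome Q (W ∖ (⁅ e ⁆ ∪ S)) ×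
        cost c (Q ∩ E) ≤ cost c (P ∩ E) + ℓ * count ((⁅ e ⁆ ∪ S) ∩ E))
      extend E with path E
      ... | Q , Q⊆ , out , loss =
        Q , subst (Q ⊆_) (∪-assoc P ⁅ e ⁆ S) Q⊆ , outcome-⊆ remaining out ,
        by (loss ⊕ single E ⊕ *-monoˡ 0≤ℓ (disjoint E))
          (solve 7 (λ q pe p l x y z →
             q :+ (((pe :+ l :* y) :+ (p :+ l :* x)) :+ l :* z)
               := (p :+ l :* z) :+ ((q :+ pe) :+ l :* (x :+ y))) refl
            (cost c (Q ∩ E)) (cost c ((P ∪ ⁅ e ⁆) ∩ E)) (cost c (P ∩ E)) ℓ
            (count (⁅ e ⁆ ∩ E)) (count (S ∩ E)) (count ((⁅ e ⁆ ∪ S) ∩ E)))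

    -- At most `N` insertions in the current class, then two subtrees for the next class, in which
    -- `2 ^ d` insertions suffice to reach the cap.
    treeSize : ℕ → ℕ → ℕ
    treeSize zero    N = 0
    treeSize (suc d) N = N ℕ.+ (treeSize d (2 ℕ.^ d) ℕ.+ treeSize d (2 ℕ.^ d))

    -- b is the lower end of the current cost class [b, 2b), d the number of classes left, and
    -- N bounds the insertions possible in this class before the path reaches cap.
    Growth : ℕ → ℕ → Set
    Growth d N = ∀ b P W → 0ℚ ≤ b → ι (2 ℕ.^ d) * b ≡ cap → cap ≤ cost c P + ι N * b →
      Dense P → cost c P < cap + cap → Rejects b P W → Extension P W (treeSize d N) (b + b)

    -- Recursion on the insertions left in one class; the growth through the later classes is passed
    -- in as an argument. With no insertion left, `room` says that the path has reached the cap.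
    grow-class : ∀ d → (∀ N → Growth d N) → ∀ N → Growth (suc d) N
    grow-class d _ zero b P W 0≤b classes room dense small rej =
      stop (+-mono-≤ 0≤b 0≤b) (dense , small ,
        inj₁ (≤-trans room (≤-reflexive (trans (cong (cost c P +_) (*-zeroˡ b)) (+-identityʳ _)))))
    grow-class d next (suc N) b P W 0≤b classes room dense small rej
      with cap ≤? cost c P
         | any? (λ e → (e ∈? W) ×-dec (¬? (e ∈? P)) ×-dec (b ≤? c e) ×-dec (c e <? b + b)
                         ×-dec (f P + θ * c e ≤? f (P ∪ ⁅ e ⁆)))
    ... | yes full | _ = stop (+-mono-≤ 0≤b 0≤b) (dense , small , inj₁ full)
    ... | no ¬full | yes (e , e∈W , e∉P , b≤ce , ce<2b , gain) =
      insert (+-mono-≤ 0≤b 0≤b) e∈W e∉P (<⇒≤ ce<2b)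
        (grow-class d next N b (P ∪ ⁅ e ⁆) (W ∖ ⁅ e ⁆) 0≤b classes
          (subst (λ x → cap ≤ x + ι N * b) (sym (cost-insert c P e e∉P)) (room-insert {p = cost c P} N room b≤ce))
          (dense-insert e∉P gain dense)
          -- The path was below the cap, and the new element costs less than `b + b`, which is at
          -- most the cap.
          (subst (_< cap + cap) (sym (cost-insert c P e e∉P))
            (+-mono-< (≰⇒> ¬full) (<-≤-trans ce<2b (2b≤cap d 0≤b classes))))
          (rejects-⊆ (⊆∪ˡ P ⁅ e ⁆) (∖⊆ W ⁅ e ⁆) rej))
    -- The class is exhausted, so rejection extends to all costs below `b + b`. The path branches
    -- into the next class with fresh room; `widen` accounts for the unspent insertions.
    ... | no _ | no none = widen (double (+-mono-≤ 0≤b 0≤b) (λ V V⊆W →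
        next (2 ℕ.^ d) (b + b) P V (+-mono-≤ 0≤b 0≤b) (next-class d b classes)
          (subst (λ x → cap ≤ cost c P + x) (sym (next-class d b classes)) (p≤q+p (cost-nonNeg 0≤c P)))
          dense small (rejects-⊆ (λ x → x) V⊆W rej′)))
      where
      rej′ : Rejects (b + b) P W
      rej′ e e∈W ce<2b with b ≤? c e | e ∈? P | f P + θ * c e ≤? f (P ∪ ⁅ e ⁆)
      ... | no b≰ce  | _       | _      = rej e e∈W (≰⇒> b≰ce)
      ... | yes b≤ce | no e∉P  | yes g  = contradiction (e , e∈W , e∉P , b≤ce , ce<2b , g) none
      ... | yes b≤ce | no e∉P  | no ¬g  = <⇒≤ (≰⇒> ¬g)
      ... | yes b≤ce | yes e∈P | _      =
        by (mono _ _ (∪-lub P ⁅ e ⁆ (λ x → x) (⁅⁆⊆ e∈P)) ⊕ *-nonNeg 0≤θ (0≤c e))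
          (solve 3 (λ u p t → u :+ (p :+ t) := (p :+ t) :+ (u :+ con 0ℚ)) refl
            (f (P ∪ ⁅ e ⁆)) (f P) (θ * c e))
      widen : ∀ {s} → Extension P W s (b + b) → Extension P W (suc N ℕ.+ s) (b + b)
      widen (S , S⊆W , ∣S∣≤s , path) = S , S⊆W , ℕₚ.≤-trans ∣S∣≤s (ℕₚ.m≤n+m _ (suc N)) , path

    grow : ∀ d N → Growth d N
    -- With no class left, `b` equals the cap, so all elements cheaper than the cap are rejected.
    grow zero N b P W 0≤b classes room dense small rej =
      stop (+-mono-≤ 0≤b 0≤b) (dense , small ,
        inj₂ (subst (λ x → Rejects x P W) (trans (sym (*-identityˡ b)) classes) rej))
    grow (suc d) = grow-class d (grow d)

    treeSize-2^ : ∀ d → treeSize d (2 ℕ.^ d) ≡ d ℕ.* 2 ℕ.^ d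
    treeSize-2^ zero    = refl
    treeSize-2^ (suc d) = cong (2 ℕ.^ suc d ℕ.+_) (begin
      treeSize d (2 ℕ.^ d) ℕ.+ treeSize d (2 ℕ.^ d)  ≡⟨ cong₂ ℕ._+_ (treeSize-2^ d) (treeSize-2^ d) ⟩
      d ℕ.* 2 ℕ.^ d ℕ.+ d ℕ.* 2 ℕ.^ d                ≡⟨ ℕₚ.*-distribˡ-+ d (2 ℕ.^ d) (2 ℕ.^ d) ⟨
      d ℕ.* (2 ℕ.^ d ℕ.+ 2 ℕ.^ d)                    ≡⟨ cong (λ x → d ℕ.* (2 ℕ.^ d ℕ.+ x)) (ℕₚ.+-identityʳ (2 ℕ.^ d)) ⟨
      d ℕ.* 2 ℕ.^ suc d                              ∎)
      where open ≡-Reasoning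

  -- The levels of halving thresholds for one guess of the optimum

  module Levels {c : Fin n → ℚ} (1≤c : CostsAtLeastOne c) (m R : ℕ) {τ : ℚ} (0≤τ : 0ℚ ≤ τ)
                {W : Subset n} (single≤τ : ∀ e → e ∈ W → f ⁅ e ⁆ ≤ τ) where

    0≤c : ∀ e → 0ℚ ≤ c e
    0≤c e = ≤-trans 0≤1 (1≤c e)

    -- The value that one level loses to m deletions.
    δ : ℚ
    δ = τ * (half R * ((ι m + ι m) + (ι m + ι m)))

    module _ (i : ℕ) where
      open Tree 0≤c (τ * half i) (ι (2 ℕ.^ i)) (*-nonNeg 0≤τ (half-nonNeg i)) public

      -- The lowest cost class starts here, so that `R` doublings end at the cap `2 ^ i`.
      bottom : ℚ
      bottom = ι (2 ℕ.^ i) * half R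

      bottom-classes : ι (2 ℕ.^ R) * bottom ≡ ι (2 ℕ.^ i)
      bottom-classes = trans
        (solve 3 (λ x y h → x :* (y :* h) := y :* (x :* h)) refl (ι (2 ℕ.^ R)) (ι (2 ℕ.^ i)) (half R))
        (trans (cong (ι (2 ℕ.^ i) *_) (2^*half R)) (*-identityʳ _))

      bottom≤1 : i ℕ.≤ R → bottom ≤ 1ℚ
      bottom≤1 i≤R = begin
        ι (2 ℕ.^ i) * half R   ≡⟨ *-comm (ι (2 ℕ.^ i)) (half R) ⟩
        half R * ι (2 ℕ.^ i)   ≤⟨ *-monoˡ (half-nonNeg R) (ι-mono (ℕₚ.^-monoʳ-≤ 2 i≤R)) ⟩
        half R * ι (2 ℕ.^ R)   ≡⟨ *-comm (half R) (ι (2 ℕ.^ R)) ⟩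
        ι (2 ℕ.^ R) * half R   ≡⟨ 2^*half R ⟩
        1ℚ                     ∎
        where open ≤-Reasoning

      tree : i ℕ.≤ R → ∀ V → Extension ⊥ V (treeSize R (2 ℕ.^ R)) (bottom + bottom)
      tree i≤R V = grow R (2 ℕ.^ R) bottom ⊥ V
        (*-nonNeg (ι-nonNeg (2 ℕ.^ i)) (half-nonNeg R)) bottom-classes
        (subst (λ x → ι (2 ℕ.^ i) ≤ cost c ⊥ + x) (sym bottom-classes) (p≤q+p (cost-nonNeg 0≤c ⊥)))
        dense-⊥ small-⊥
        -- The initial rejection is vacuous: `bottom` is at most 1, and no element costs less than
        -- 1.
        (λ e _ ce<b → contradiction (<-≤-trans ce<b (≤-trans (bottom≤1 i≤R) (1≤c e))) (<-irrefl refl))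
        where
        dense-⊥ : Dense ⊥
        dense-⊥ E = subst (_≤ f (⊥ ∖ E))
          (sym (trans (cong (λ X → (τ * half i) * cost c X) (⊆-antisym (∖⊆ ⊥ E) (⊆-min _)))
            (trans (cong ((τ * half i) *_) (cost-⊥ c)) (*-zeroʳ (τ * half i))))) (0≤f _)
        small-⊥ : cost c ⊥ < ι (2 ℕ.^ i) + ι (2 ℕ.^ i)
        small-⊥ = subst (_< ι (2 ℕ.^ i) + ι (2 ℕ.^ i)) (sym (cost-⊥ c))
          (+-mono-<-≤ (<-≤-trans (positive⁻¹ 1ℚ) (1≤2^ i)) (ι-nonNeg (2 ℕ.^ i)))

    -- The path of level `i + 1` loses cost at most `2m · 2 ^ (i + 1) / 2 ^ R`. It is weighed with
    -- the threshold `τ / 2 ^ i` of the previous level, which rejected these elements; the powers of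
    -- `i` cancel.
    level-loss : ∀ i {Q 𝒮 E} → ∣ E ∣ ℕ.≤ m →
      cost c (Q ∩ E) ≤ cost c (⊥ ∩ E) + (bottom (suc i) + bottom (suc i)) * count (𝒮 ∩ E) →
      (τ * half i) * cost c (Q ∩ E) ≤ δ
    level-loss i {Q} {𝒮} {E} ∣E∣≤m loss = begin
      t * cost c (Q ∩ E)   ≤⟨ *-monoˡ (*-nonNeg 0≤τ (half-nonNeg i)) loss ⟩
      t * (cost c (⊥ ∩ E) + (g + g) * count (𝒮 ∩ E))
        ≤⟨ *-monoˡ (*-nonNeg 0≤τ (half-nonNeg i)) (+-mono-≤ deleted-⊥ (*-monoˡ 0≤g+g deleted)) ⟩
      t * (0ℚ + (g + g) * ι m)
        ≡⟨ cong (λ x → t * (0ℚ + (x * half R + x * half R) * ι m)) (ι-2^suc i) ⟩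
      t * (0ℚ + ((ι (2 ℕ.^ i) + ι (2 ℕ.^ i)) * half R + (ι (2 ℕ.^ i) + ι (2 ℕ.^ i)) * half R) * ι m)
        ≡⟨ solve 5 (λ t h x r m → (t :* h) :* (con 0ℚ :+ ((x :+ x) :* r :+ (x :+ x) :* r) :* m)
              := (x :* h) :* (t :* (r :* ((m :+ m) :+ (m :+ m))))) refl
             τ (half i) (ι (2 ℕ.^ i)) (half R) (ι m) ⟩
      (ι (2 ℕ.^ i) * half i) * δ   ≡⟨ cong (_* δ) (2^*half i) ⟩
      1ℚ * δ                       ≡⟨ *-identityˡ δ ⟩
      δ                            ∎
      where
      open ≤-Reasoning
      t = τ * half i
      g = bottom (suc i)
      0≤g : 0ℚ ≤ g
      0≤g = *-nonNeg (ι-nonNeg (2 ℕ.^ suc i)) (half-nonNeg R)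
      0≤g+g = +-mono-≤ 0≤g 0≤g
      deleted-⊥ : cost c (⊥ ∩ E) ≤ 0ℚ
      deleted-⊥ = ≤-trans (cost-mono 0≤c (p∩q⊆p ⊥ E)) (≤-reflexive (cost-⊥ c))
      deleted : count (𝒮 ∩ E) ≤ ι m
      deleted = ≤-trans (≤-reflexive (cost-one (𝒮 ∩ E)))
        (ι-mono (ℕₚ.≤-trans (∣p∩q∣≤∣q∣ 𝒮 E) ∣E∣≤m))

    Full : ℕ → Subset n → Subset n → Set
    Full i 𝒮 E = ∃[ Z ] (Z ⊆ 𝒮 ∖ E × cost c Z ≤ ι (budget i) × τ ≤ f Z + f Z)

    -- `U` is the union of the chosen paths so far; each level adds one `δ` to the value lost by
    -- deletion.
    Covered : ℕ → Subset n → Subset n → Set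
    Covered i 𝒮 E = ∃[ U ] (U ⊆ 𝒮 × cost c U ≤ ι (budget i) × f U ≤ f (U ∖ E) + ι i * δ ×
      (∀ e → e ∈ W ∖ 𝒮 → f (U ∪ ⁅ e ⁆) ≤ f U + (τ * half i) * c e))

    θ-suc : ∀ i → τ * half i ≡ τ * half (suc i) + τ * half (suc i)
    θ-suc i = trans (cong (τ *_) (sym (half-suc i))) (*-distribˡ-+ τ (half (suc i)) (half (suc i)))

    θ-cap : ∀ i → (τ * half i) * ι (2 ℕ.^ i) ≡ τ
    θ-cap i = trans (solve 3 (λ t h x → (t :* h) :* x := t :* (x :* h)) refl τ (half i) (ι (2 ℕ.^ i)))
                (trans (cong (τ *_) (2^*half i)) (*-identityʳ τ))

    -- At threshold `τ / 2 ^ (i + 1)` the whole path weighs at least `τ`. Its deleted part weighs at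
    -- most half of `δ`, hence at most `τ / 2`, and density turns the rest into value.
    full-step : ∀ i {Q 𝒮 E} → Dense (suc i) Q → cost c Q < ι (2 ℕ.^ suc i) + ι (2 ℕ.^ suc i) →
      ι (2 ℕ.^ suc i) ≤ cost c Q → (τ * half i) * cost c (Q ∩ E) ≤ δ → δ ≤ τ → Q ⊆ 𝒮 →
      Full (suc i) 𝒮 E
    full-step i {Q} {𝒮} {E} dense small full loss δ≤τ Q⊆𝒮 =
      Q ∖ E , ∖-monoˡ Q 𝒮 E Q⊆𝒮 ,
      ≤-trans (cost-mono 0≤c (∖⊆ Q E)) (≤-trans (<⇒≤ small) (≤-reflexive (sym (ι-2^suc (suc i))))) ,
      by (subst (λ x → x * cost c (Q ∩ E) ≤ δ) (θ-suc i) loss ⊕ δ≤τ ⊕ dense E ⊕ dense E ⊕ enough ⊕ enough)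
        (solve 6 (λ t d u x y v →
           t :+ (((((d :+ t) :+ v) :+ v) :+ u :* (x :+ y)) :+ u :* (x :+ y))
             := (v :+ v) :+ ((((((u :+ u) :* x :+ d) :+ u :* y) :+ u :* y) :+ t) :+ t)) refl
          τ δ (τ * half (suc i)) (cost c (Q ∩ E)) (cost c (Q ∖ E)) (f (Q ∖ E)))
      where
      enough : τ ≤ (τ * half (suc i)) * (cost c (Q ∩ E) + cost c (Q ∖ E))
      enough = ≤-trans (≤-reflexive (sym (θ-cap (suc i))))
        (*-monoˡ (*-nonNeg 0≤τ (half-nonNeg (suc i))) (≤-trans full (≤-reflexive (cost-split c Q E))))

    -- Removing the deleted part of `Q` costs at most its gain over `U`, and level `i` rejected its
    -- elements, so this is at most `δ`. Deleting from `U` afterwards costs at most what it cost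
    -- without `Q`.
    covered-step : ∀ i {U Q S T E} → U ⊆ S → Q ⊆ T → T ⊆ W ∖ S → cost c U ≤ ι (budget i) →
      f U ≤ f (U ∖ E) + ι i * δ → (∀ e → e ∈ W ∖ S → f (U ∪ ⁅ e ⁆) ≤ f U + (τ * half i) * c e) →
      cost c Q ≤ ι (2 ℕ.^ suc i) → Rejects (suc i) (ι (2 ℕ.^ suc i)) Q (W ∖ S ∖ T) →
      (τ * half i) * cost c (Q ∩ E) ≤ δ → Covered (suc i) (S ∪ T) E
    covered-step i {U} {Q} {S} {T} {E} U⊆S Q⊆T T⊆ cU fU rejU cQ rejQ loss =
      U ∪ Q , ∪-lub U Q (⊆∪ˡ S T ∘ U⊆S) (⊆∪ʳ S T ∘ Q⊆T) ,
      ≤-trans (cost-subadd 0≤c U Q) (≤-trans (+-mono-≤ cU cQ)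
        (≤-trans (≤-reflexive (sym (ι-+ (budget i) (2 ℕ.^ suc i)))) (ι-mono (budget-suc i)))) ,
      robust , reject
      where
      B = U ∪ (Q ∖ E)
      B∪Q∩E : U ∪ Q ⊆ B ∪ (Q ∩ E)
      B∪Q∩E = ∪-lub U Q (⊆∪ˡ B (Q ∩ E) ∘ ⊆∪ˡ U (Q ∖ E)) Q⊆
        where
        Q⊆ : Q ⊆ B ∪ (Q ∩ E)
        Q⊆ {x} x∈Q with x ∈? E
        ... | yes x∈E = ⊆∪ʳ B (Q ∩ E) (x∈p∩q⁺ (x∈Q , x∈E))
        ... | no  x∉E = ⊆∪ˡ B (Q ∩ E) (⊆∪ʳ U (Q ∖ E) (∈∖⁺ x∈Q x∉E))
      remainder⊆ : (U ∖ E) ∪ (Q ∖ E) ⊆ (U ∪ Q) ∖ E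
      remainder⊆ = ∪-lub (U ∖ E) (Q ∖ E) (∖-monoˡ U (U ∪ Q) E (⊆∪ˡ U Q)) (∖-monoˡ Q (U ∪ Q) E (⊆∪ʳ U Q))
      robust : f (U ∪ Q) ≤ f ((U ∪ Q) ∖ E) + ι (suc i) * δ
      robust = by (mono _ _ B∪Q∩E ⊕ gain-antitone-∪ (⊆∪ˡ U (Q ∖ E)) (Q ∩ E)
          ⊕ gain-bound-∪ c (τ * half i) U (Q ∩ E) (λ e e∈ → rejU e (T⊆ (Q⊆T (p∩q⊆p Q E e∈))))
          ⊕ loss ⊕ gain-antitone-∪ (∖⊆ U E) (Q ∖ E) ⊕ mono _ _ remainder⊆ ⊕ fU)
        (solve 11 (λ uq bq ub u b l d ueqe ue uqe i →
            uq :+ ((((((bq :+ (ub :+ b)) :+ (u :+ l)) :+ d) :+ (ueqe :+ u)) :+ uqe) :+ (ue :+ i :* d))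
              := (uqe :+ (con 1ℚ :+ i) :* d)
                   :+ ((((((uq :+ (bq :+ u)) :+ ub) :+ l) :+ (b :+ ue)) :+ ueqe) :+ u)) refl
          (f (U ∪ Q)) (f (B ∪ (Q ∩ E))) (f (U ∪ (Q ∩ E))) (f U) (f B) ((τ * half i) * cost c (Q ∩ E)) δ
          (f ((U ∖ E) ∪ (Q ∖ E))) (f (U ∖ E)) (f ((U ∪ Q) ∖ E)) (ι i))
      reject : ∀ e → e ∈ W ∖ (S ∪ T) → f ((U ∪ Q) ∪ ⁅ e ⁆) ≤ f (U ∪ Q) + (τ * half (suc i)) * c e
      reject e e∈ with ∈∖⁻ W (S ∪ T) e∈ | c e <? ι (2 ℕ.^ suc i)
      ... | e∈W , e∉ | yes ce<cap = rejects-⊆ (suc i) {b = ι (2 ℕ.^ suc i)} {W = W ∖ S ∖ T}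
        (⊆∪ʳ U Q) (λ x → x) rejQ e (∈∖⁺ (∈∖⁺ e∈W (proj₁ (∉∪ e∉))) (proj₂ (∉∪ e∉))) ce<cap
      -- An element that costs at least `2 ^ (i + 1)` lies outside the cost classes; its whole value
      -- is at most `τ`, which is the threshold times the cap.
      ... | e∈W , e∉ | no  ce≮cap = ≤-trans (subadditive (U ∪ Q) ⁅ e ⁆)
        (+-monoʳ-≤ (f (U ∪ Q)) (≤-trans (single≤τ e e∈W) (≤-trans (≤-reflexive (sym (θ-cap (suc i))))
          (*-monoˡ (*-nonNeg 0≤τ (half-nonNeg (suc i))) (≮⇒≥ ce≮cap)))))

    δ-nonNeg : 0ℚ ≤ δ
    δ-nonNeg = *-nonNeg 0≤τ (*-nonNeg (half-nonNeg R)
      (+-mono-≤ (+-mono-≤ (ι-nonNeg m) (ι-nonNeg m)) (+-mono-≤ (ι-nonNeg m) (ι-nonNeg m))))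

    Level : ℕ → Set
    Level i = ∃[ 𝒮 ] (∣ 𝒮 ∣ ℕ.≤ i ℕ.* (R ℕ.* 2 ℕ.^ R) ×
      (∀ E → ∣ E ∣ ℕ.≤ m → Full i 𝒮 E ⊎ Covered i 𝒮 E))

    -- The empty set already rejects everything at threshold `τ`: singletons are worth at most `τ`
    -- and cost at least 1.
    level-zero : Level 0
    level-zero = ⊥ , ℕₚ.≤-reflexive (∣⊥∣≡0 n) , λ E _ → inj₂ (⊥ , (λ x → x) ,
      ≤-reflexive (cost-⊥ c) ,
      ≤-trans (mono _ _ (⊆-min (⊥ ∖ E))) (p≤p+q (*-nonNeg (ι-nonNeg 0) δ-nonNeg)) ,
      λ e e∈ → ≤-trans (subadditive ⊥ ⁅ e ⁆) (+-monoʳ-≤ (f ⊥) (≤-trans (single≤τ e (∖⊆ W ⊥ e∈)) (τ≤ e))))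
      where
      τ≤ : ∀ e → τ ≤ (τ * 1ℚ) * c e
      τ≤ e = subst (τ ≤_) (cong (_* c e) (sym (*-identityʳ τ)))
        (subst (_≤ τ * c e) (*-identityʳ τ) (*-monoˡ 0≤τ (1≤c e)))

    level-suc : ∀ i → δ ≤ τ → suc i ℕ.≤ R → Level i → Level (suc i)
    level-suc i δ≤τ i<R (S , ∣S∣≤ , outcome) = extend (tree (suc i) i<R (W ∖ S))
      where
      extend : Extension (suc i) ⊥ (W ∖ S) (treeSize (suc i) R (2 ℕ.^ R)) (bottom (suc i) + bottom (suc i)) →
               Level (suc i)
      extend (T , T⊆ , ∣T∣≤ , path) = S ∪ T ,
        ℕₚ.≤-trans (∣∪∣≤ S T) (ℕₚ.≤-trans (ℕₚ.≤-reflexive (ℕₚ.+-comm ∣ S ∣ ∣ T ∣))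
          (ℕₚ.+-mono-≤ (subst (∣ T ∣ ℕ.≤_) (treeSize-2^ (suc i) R) ∣T∣≤) ∣S∣≤)) ,
        λ E ∣E∣≤m → step E ∣E∣≤m (outcome E ∣E∣≤m) (path E)
        where
        step : ∀ E → ∣ E ∣ ℕ.≤ m → Full i S E ⊎ Covered i S E →
               ∃[ Q ] (Q ⊆ ⊥ ∪ T × Outcome (suc i) Q (W ∖ S ∖ T) ×
                 cost c (Q ∩ E) ≤ cost c (⊥ ∩ E) + (bottom (suc i) + bottom (suc i)) * count (T ∩ E)) →
               Full (suc i) (S ∪ T) E ⊎ Covered (suc i) (S ∪ T) E
        step E ∣E∣≤m (inj₁ (Z , Z⊆ , cZ , fZ)) _ =
          inj₁ (Z , ∖-monoˡ S (S ∪ T) E (⊆∪ˡ S T) ∘ Z⊆ , ≤-trans cZ (ι-mono (budget-mono i)) , fZ)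
        step E ∣E∣≤m (inj₂ (U , U⊆ , cU , fU , rejU)) (Q , Q⊆ , (dense , small , outQ) , loss) = case outQ
          where
          Q⊆T : Q ⊆ T
          Q⊆T = subst (Q ⊆_) (∪-identityˡ T) Q⊆
          loss≤δ : (τ * half i) * cost c (Q ∩ E) ≤ δ
          loss≤δ = level-loss i {Q} {T} ∣E∣≤m loss
          full-case : ι (2 ℕ.^ suc i) ≤ cost c Q → Full (suc i) (S ∪ T) E
          full-case full = full-step i dense small full loss≤δ δ≤τ (⊆∪ʳ S T ∘ Q⊆T)
          case : ι (2 ℕ.^ suc i) ≤ cost c Q ⊎ Rejects (suc i) (ι (2 ℕ.^ suc i)) Q (W ∖ S ∖ T) →
                 Full (suc i) (S ∪ T) E ⊎ Covered (suc i) (S ∪ T) E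
          case (inj₁ full) = inj₁ (full-case full)
          -- A rejecting path may have reached the cap as well; the budget of `U` admits only paths
          -- below it.
          case (inj₂ rejQ) with ι (2 ℕ.^ suc i) ≤? cost c Q
          ... | yes full = inj₁ (full-case full)
          ... | no ¬full = inj₂ (covered-step i U⊆ Q⊆T T⊆ cU fU rejU (<⇒≤ (≰⇒> ¬full)) rejQ loss≤δ)

    levels : δ ≤ τ → ∀ i → i ℕ.≤ R → Level i
    levels δ≤τ zero    _   = level-zero
    levels δ≤τ (suc i) i<R = level-suc i δ≤τ i<R (levels δ≤τ i (ℕₚ.<⇒≤ i<R))

    deletions≤ : ∀ j → (m ℕ.+ m ℕ.+ (m ℕ.+ m)) ℕ.* j ℕ.≤ 2 ℕ.^ R → ι j * δ ≤ τ
    deletions≤ j bound = begin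
      ι j * δ                    ≡⟨ solve 4 (λ j t h m → j :* (t :* (h :* ((m :+ m) :+ (m :+ m)))) := (t :* h) :* (((m :+ m) :+ (m :+ m)) :* j)) refl (ι j) τ (half R) (ι m) ⟩
      (τ * half R) * (((ι m + ι m) + (ι m + ι m)) * ι j)
        ≡⟨ cong ((τ * half R) *_) (sym (trans (ι-* (m ℕ.+ m ℕ.+ (m ℕ.+ m)) j)
             (cong (_* ι j) (trans (ι-+ (m ℕ.+ m) (m ℕ.+ m)) (cong₂ _+_ (ι-+ m m) (ι-+ m m)))))) ⟩
      (τ * half R) * ι ((m ℕ.+ m ℕ.+ (m ℕ.+ m)) ℕ.* j)
        ≤⟨ *-monoˡ (*-nonNeg 0≤τ (half-nonNeg R)) (ι-mono bound) ⟩
      (τ * half R) * ι (2 ℕ.^ R)   ≡⟨ θ-cap R ⟩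
      τ                            ∎
      where open ≤-Reasoning

    -- In the covered case an outside set of cost `K ≤ 4 · 2 ^ L` gains at most `4τ` over `U` at the
    -- last threshold, and the deletions over all `L` levels cost at most another `τ`.
    summary : ∀ {K} L → L ℕ.≤ R → δ ≤ τ → ι L * δ ≤ τ → ι (budget L) ≤ K → K ≤ ι (2 ℕ.^ suc (suc L)) →
      ∃[ 𝒮 ] (∣ 𝒮 ∣ ℕ.≤ L ℕ.* (R ℕ.* 2 ℕ.^ R) × (∀ E → ∣ E ∣ ℕ.≤ m →
        ∃[ Z ] (Z ⊆ 𝒮 ∖ E × cost c Z ≤ K × (τ ≤ f Z + f Z ⊎
          (∀ O → O ⊆ W ∖ 𝒮 → cost c O ≤ K → f O ≤ f Z + (τ + (τ + τ + (τ + τ))))))))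
    summary {K} L L≤R δ≤τ Lδ≤τ budget≤K K≤ with levels δ≤τ L L≤R
    ... | 𝒮 , ∣𝒮∣≤ , outcome = 𝒮 , ∣𝒮∣≤ , λ E ∣E∣≤m → answer E (outcome E ∣E∣≤m)
      where
      θK≤4τ : (τ * half L) * K ≤ τ + τ + (τ + τ)
      θK≤4τ = begin
        (τ * half L) * K                          ≤⟨ *-monoˡ (*-nonNeg 0≤τ (half-nonNeg L)) K≤ ⟩
        (τ * half L) * ι (2 ℕ.^ suc (suc L))      ≡⟨ cong ((τ * half L) *_) (trans (ι-2^suc (suc L)) (cong₂ _+_ (ι-2^suc L) (ι-2^suc L))) ⟩
        (τ * half L) * (x + x + (x + x))          ≡⟨ solve 2 (λ t x → t :* (x :+ x :+ (x :+ x)) := t :* x :+ t :* x :+ (t :* x :+ t :* x)) refl (τ * half L) x ⟩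
        (τ * half L) * x + (τ * half L) * x + ((τ * half L) * x + (τ * half L) * x)
          ≡⟨ cong (λ y → y + y + (y + y)) (θ-cap L) ⟩
        τ + τ + (τ + τ)                           ∎
        where
        open ≤-Reasoning
        x = ι (2 ℕ.^ L)
      answer : ∀ E → Full L 𝒮 E ⊎ Covered L 𝒮 E → ∃[ Z ] (Z ⊆ 𝒮 ∖ E × cost c Z ≤ K × (τ ≤ f Z + f Z ⊎
          (∀ O → O ⊆ W ∖ 𝒮 → cost c O ≤ K → f O ≤ f Z + (τ + (τ + τ + (τ + τ))))))
      answer E (inj₁ (Z , Z⊆ , cZ , fZ)) = Z , Z⊆ , ≤-trans cZ budget≤K , inj₁ fZ
      answer E (inj₂ (U , U⊆ , cU , fU , rej)) =
        U ∖ E , ∖-monoˡ U 𝒮 E U⊆ , ≤-trans (cost-mono 0≤c (∖⊆ U E)) (≤-trans cU budget≤K) ,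
        inj₂ λ O O⊆ cO → by
          (mono _ _ (⊆∪ʳ U O) ⊕ gain-bound-∪ c (τ * half L) U O (λ e e∈ → rej e (O⊆ e∈))
            ⊕ *-monoˡ (*-nonNeg 0≤τ (half-nonNeg L)) cO ⊕ θK≤4τ ⊕ fU ⊕ Lδ≤τ)
          (solve 9 (λ o uo u x k t4 ue l t →
             o :+ (((((uo :+ (u :+ x)) :+ k) :+ t4) :+ (ue :+ l)) :+ t)
               := (ue :+ (t :+ t4)) :+ (((((o :+ uo) :+ x) :+ k) :+ u) :+ l)) refl
            (f O) (f (U ∪ O)) (f U) ((τ * half L) * cost c O) ((τ * half L) * K) (τ + τ + (τ + τ)) (f (U ∖ E)) (ι L * δ) τ)

-- Guessing the optimum and assembling the summary

module Summary {n : ℕ} {f : Subset n → ℚ} {c : Fin n → ℚ} {K : ℚ} (m : ℕ)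
  (0≤f : NonNegative f) (mono : Monotone f) (submod : Submodular f) (1≤c : CostsAtLeastOne c) (0≤K : 0ℚ ≤ K)
  where

  0≤c : ∀ e → 0ℚ ≤ c e
  0≤c e = ≤-trans 0≤1 (1≤c e)

  Answers : Subset n → Subset n → Subset n → Set
  Answers 𝒮 E Z = Z ⊆ 𝒮 ∩ ∁ E × cost c Z ≤ K

  Robust : Subset n → Set
  Robust 𝒮 = ∀ E → ∣ E ∣ ℕ.≤ m → ∃[ Z ] (Answers 𝒮 E Z × (∀ O → IsOPT f c K (∁ E) O → half 5 * f O ≤ f Z))

  -- Restricting to these elements loses no feasible set and makes every singleton feasible.
  affordable : Subset n
  affordable = filter (λ e → c e ≤? K)

  feasible⊆affordable : ∀ {O} → cost c O ≤ K → O ⊆ affordable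
  feasible⊆affordable cO o∈O = ∈filter⁺ (λ e → c e ≤? K) (≤-trans (cost-∈ 0≤c o∈O) cO)

  -- The answer is the best feasible subset of the surviving summary, so its value dominates every
  -- set that the analysis builds there.
  robust : ∀ 𝒮 → (∀ E Z O → ∣ E ∣ ℕ.≤ m → (∀ X → Answers 𝒮 E X → f X ≤ f Z) → O ⊆ ∁ E → cost c O ≤ K →
           f O ≤ 16* (f Z) + 16* (f Z)) → Robust 𝒮
  robust 𝒮 bound E ∣E∣≤m with argmax f {Answers 𝒮 E} (λ X → (X ⊆? 𝒮 ∩ ∁ E) ×-dec (cost c X ≤? K))
  ... | inj₂ none = ⊥-elim (none ⊥ (⊆-min (𝒮 ∩ ∁ E) , subst (_≤ K) (sym (cost-⊥ c)) 0≤K))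
  ... | inj₁ (Z , answers , best) = Z , answers , λ O ((O⊆ , cO) , _) →
    ≤-trans (*-monoˡ (half-nonNeg 5) (bound E Z O ∣E∣≤m best O⊆ cO)) (≤-reflexive (half-32 (f Z)))

  covers-affordable : ∀ {T} → affordable ⊆ T → Robust T
  covers-affordable {T} ⊆T = robust T λ E Z O _ best O⊆ cO →
    let fO≤v = best O ((λ o∈O → x∈p∩q⁺ (⊆T (feasible⊆affordable cO o∈O) , O⊆ o∈O)) , cO)
    in ≤-trans fO≤v (≤-trans (16*-inflationary (0≤f Z)) (p≤p+q (≤-trans (0≤f Z) (16*-inflationary (0≤f Z)))))

  module Guesses (params : Parameters (natFloor K) m) where
    open Parameters params

    budget≤K : ι (budget L) ≤ K
    budget≤K = ≤-trans (ι-mono budget≤) (proj₁ (ι-natFloor 0≤K))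

    K≤4·2^L : K ≤ ι (2 ℕ.^ suc (suc L))
    K≤4·2^L = <⇒≤ (<-≤-trans (proj₂ (ι-natFloor 0≤K)) (ι-mono k<))

    module _ {T} (T⊆ : T ⊆ affordable) (∣T∣≤ : ∣ T ∣ ℕ.≤ suc m) (m<∣T∣ : suc m ℕ.≤ ∣ T ∣)
      {Δ} (0≤Δ : 0ℚ ≤ Δ) (Δ≤ : ∀ x → x ∈ T → Δ ≤ f ⁅ x ⁆) (≤Δ : ∀ e → e ∈ affordable ∖ T → f ⁅ e ⁆ ≤ Δ)
      where

      W : Subset n
      W = affordable ∖ T

      -- The values tried for `τ`. All are at least `Δ`, hence at least every singleton value in
      -- `W`.
      guess : ℕ → ℚ
      guess t = ι (2 ℕ.^ t) * Δ

      0≤guess : ∀ t → 0ℚ ≤ guess t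
      0≤guess t = *-nonNeg (ι-nonNeg (2 ℕ.^ t)) 0≤Δ

      Δ≤guess : ∀ t → Δ ≤ guess t
      Δ≤guess t = subst (_≤ guess t) (*-identityˡ Δ)
        (subst (1ℚ * Δ ≤_) (*-comm Δ (ι (2 ℕ.^ t))) (subst (_≤ Δ * ι (2 ℕ.^ t)) (*-comm Δ 1ℚ) (*-monoˡ 0≤Δ (1≤2^ t))))

      SummaryFor : ℕ → Subset n → Set
      SummaryFor t 𝒮 = ∣ 𝒮 ∣ ℕ.≤ L ℕ.* (R ℕ.* 2 ℕ.^ R) × (∀ E → ∣ E ∣ ℕ.≤ m →
        ∃[ Z ] (Z ⊆ 𝒮 ∖ E × cost c Z ≤ K × (guess t ≤ f Z + f Z ⊎
          (∀ O → O ⊆ W ∖ 𝒮 → cost c O ≤ K →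
            f O ≤ f Z + (guess t + (guess t + guess t + (guess t + guess t)))))))

      guess-summary : ∀ t → ∃[ 𝒮 ] SummaryFor t 𝒮
      guess-summary t = summary L L≤R δ≤τ (deletions≤ L deletions-L) budget≤K K≤4·2^L
        where
        open Levels 0≤f mono submod 1≤c m R (0≤guess t) {W} (λ e e∈W → ≤-trans (≤Δ e e∈W) (Δ≤guess t))
        δ≤τ : δ ≤ guess t
        δ≤τ = subst (_≤ guess t) (*-identityˡ δ) (deletions≤ 1 deletions)

      module Union (part : ℕ → Subset n) (part-summary : ∀ t → SummaryFor t (part t)) where

        𝒮 : Subset n
        𝒮 = T ∪ ⋃< (suc L) part

        ∣𝒮∣≤ : ∣ 𝒮 ∣ ℕ.≤ SoftBound 81 4 K m
        ∣𝒮∣≤ = ℕₚ.≤-trans (∣∪∣≤ T (⋃< (suc L) part)) (ℕₚ.≤-trans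
          (ℕₚ.+-mono-≤ ∣T∣≤ (∣⋃<∣≤ part (λ t → proj₁ (part-summary t)) (suc L))) size)

        module Bound {E Z O : Subset n} (∣E∣≤m : ∣ E ∣ ℕ.≤ m) (best : ∀ X → Answers 𝒮 E X → f X ≤ f Z)
                     (O⊆ : O ⊆ ∁ E) (cO : cost c O ≤ K) where

          v = f Z

          inside-part : f (O ∩ 𝒮) ≤ v
          inside-part = best (O ∩ 𝒮) ((λ x∈ → let x∈O , x∈𝒮 = x∈p∩q⁻ O 𝒮 x∈ in x∈p∩q⁺ (x∈𝒮 , O⊆ x∈O)) ,
            ≤-trans (cost-mono 0≤c (p∩q⊆p O 𝒮)) cO)

          -- `T` has more elements than can be deleted, and a survivor is feasible on its own.
          Δ≤v : Δ ≤ v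
          Δ≤v with ∣>∣⇒survivor T E (ℕₚ.≤-<-trans ∣E∣≤m m<∣T∣)
          ... | x , x∈T , x∉E = ≤-trans (Δ≤ x x∈T) (best ⁅ x ⁆
            (⁅⁆⊆ (∈∖⁺ (⊆∪ˡ T (⋃< (suc L) part) x∈T) x∉E) ,
             subst (_≤ K) (sym (cost-⁅⁆ c x)) (∈filter⁻ (λ e → c e ≤? K) (T⊆ x∈T))))

          rest⊆W : O ∖ 𝒮 ⊆ W
          rest⊆W x∈ with ∈∖⁻ O 𝒮 x∈
          ... | x∈O , x∉𝒮 = ∈∖⁺ (feasible⊆affordable cO x∈O) (proj₁ (∉∪ x∉𝒮))

          rest⊆ : ∀ {t} → t ℕ.≤ L → O ∖ 𝒮 ⊆ W ∖ part t
          rest⊆ t≤L x∈ = ∈∖⁺ (rest⊆W x∈)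
            (proj₂ (∉∪ (proj₂ (∈∖⁻ O 𝒮 x∈))) ∘ ⊆⋃< part (s≤s t≤L))

          cost-rest : cost c (O ∖ 𝒮) ≤ K
          cost-rest = ≤-trans (cost-mono 0≤c (∖⊆ O 𝒮)) cO

          split : f O ≤ f (O ∩ 𝒮) + f (O ∖ 𝒮)
          split = ≤-trans (mono _ _ O⊆∪) (subadditive 0≤f mono submod (O ∩ 𝒮) (O ∖ 𝒮))
            where
            O⊆∪ : O ⊆ (O ∩ 𝒮) ∪ (O ∖ 𝒮)
            O⊆∪ {x} x∈O with x ∈? 𝒮
            ... | yes x∈𝒮 = ⊆∪ˡ (O ∩ 𝒮) (O ∖ 𝒮) (x∈p∩q⁺ (x∈O , x∈𝒮))
            ... | no  x∉𝒮 = ⊆∪ʳ (O ∩ 𝒮) (O ∖ 𝒮) (∈∖⁺ x∈O x∉𝒮)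

          -- All guesses are at most 2v, so Δ K ≤ 8v and the singletons alone bound f.
          low : guess L ≤ v + v → f (O ∖ 𝒮) ≤ v + ((v + v) + (v + v) + ((v + v) + (v + v)))
          low guess≤ = begin
            f (O ∖ 𝒮)                                ≤⟨ mono _ _ (⊆∪ʳ ⊥ (O ∖ 𝒮)) ⟩
            f (⊥ ∪ (O ∖ 𝒮))                          ≤⟨ gain-bound-∪ 0≤f mono submod c Δ ⊥ (O ∖ 𝒮) single ⟩
            f ⊥ + Δ * cost c (O ∖ 𝒮)                 ≤⟨ +-mono-≤ (best ⊥ (⊆-min _ , subst (_≤ K) (sym (cost-⊥ c)) 0≤K)) (*-monoˡ 0≤Δ (≤-trans cost-rest K≤4·2^L)) ⟩
            v + Δ * ι (2 ℕ.^ suc (suc L))            ≡⟨ cong (λ x → v + Δ * x) (trans (ι-2^suc (suc L)) (cong₂ _+_ (ι-2^suc L) (ι-2^suc L))) ⟩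
            v + Δ * (y + y + (y + y))                ≡⟨ solve 3 (λ v d y → v :+ d :* (y :+ y :+ (y :+ y)) := v :+ (y :* d :+ y :* d :+ (y :* d :+ y :* d))) refl v Δ y ⟩
            v + (y * Δ + y * Δ + (y * Δ + y * Δ))    ≤⟨ +-monoʳ-≤ v (+-mono-≤ (+-mono-≤ guess≤ guess≤) (+-mono-≤ guess≤ guess≤)) ⟩
            v + ((v + v) + (v + v) + ((v + v) + (v + v))) ∎
            where
            open ≤-Reasoning
            y = ι (2 ℕ.^ L)
            single : ∀ e → e ∈ O ∖ 𝒮 → f (⊥ ∪ ⁅ e ⁆) ≤ f ⊥ + Δ * c e
            single e e∈ = ≤-trans (subadditive 0≤f mono submod ⊥ ⁅ e ⁆) (+-monoʳ-≤ (f ⊥)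
              (≤-trans (≤Δ e (rest⊆W e∈)) (subst (_≤ Δ * c e) (*-identityʳ Δ) (*-monoˡ 0≤Δ (1≤c e)))))

          -- A part whose answer is worth half of the guess would beat `v`, so for a guess above
          -- `2v` only the covering alternative remains.
          high : ∀ {t} → t ℕ.≤ L → v + v < guess t → guess t ≤ (v + v) + (v + v) →
                 f (O ∖ 𝒮) ≤ v + (guess t + (guess t + guess t + (guess t + guess t)))
          high {t} t≤L 2v< ≤4v = conclude (proj₂ (part-summary t) E ∣E∣≤m)
            where
            conclude : ∃[ Y ] (Y ⊆ part t ∖ E × cost c Y ≤ K × (guess t ≤ f Y + f Y ⊎
                (∀ O → O ⊆ W ∖ part t → cost c O ≤ K →
                  f O ≤ f Y + (guess t + (guess t + guess t + (guess t + guess t)))))) →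
              f (O ∖ 𝒮) ≤ v + (guess t + (guess t + guess t + (guess t + guess t)))
            conclude (Y , Y⊆ , cY , value) = by-value value
              where
              fY≤v : f Y ≤ v
              fY≤v = best Y (∖-monoˡ (part t) 𝒮 E (⊆∪ʳ T (⋃< (suc L) part) ∘ ⊆⋃< part (s≤s t≤L)) ∘ Y⊆ , cY)
              by-value : (guess t ≤ f Y + f Y ⊎ (∀ O → O ⊆ W ∖ part t → cost c O ≤ K →
                  f O ≤ f Y + (guess t + (guess t + guess t + (guess t + guess t))))) →
                f (O ∖ 𝒮) ≤ v + (guess t + (guess t + guess t + (guess t + guess t)))
              by-value (inj₁ large) = contradiction (<-≤-trans 2v< (≤-trans large (+-mono-≤ fY≤v fY≤v))) (<-irrefl refl)
              by-value (inj₂ cover) = ≤-trans (cover (O ∖ 𝒮) (rest⊆ t≤L) cost-rest) (+-monoˡ-≤ _ fY≤v)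

          0≤v = 0≤f Z

          bound : f O ≤ 16* v + 16* v
          bound with doubling-search {v = v} (≤-trans Δ≤v (p≤p+q 0≤v)) L
          -- The inside part gives `v` and the rest `9v`, which leaves a slack of `22v` below `32v`.
          ... | inj₁ guess≤ = by (split ⊕ inside-part ⊕ low guess≤ ⊕ ≤22)
            (solve 4 (λ o i r v → let 2v = v :+ v ; 4v = 2v :+ 2v ; 8v = 4v :+ 4v ; 16v = 8v :+ 8v in
                o :+ ((((i :+ r) :+ v) :+ (v :+ 8v)) :+ (16v :+ (4v :+ 2v)))
                  := (16v :+ 16v) :+ (((o :+ i) :+ r) :+ con 0ℚ)) refl (f O) (f (O ∩ 𝒮)) (f (O ∖ 𝒮)) v)
            where
            ≤2 = +-nonNeg 0≤v 0≤v
            ≤4 = +-nonNeg ≤2 ≤2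
            ≤8 = +-nonNeg ≤4 ≤4
            ≤22 : 0ℚ ≤ 16* v + ((v + v) + (v + v) + (v + v))
            ≤22 = +-nonNeg (+-nonNeg ≤8 ≤8) (+-nonNeg ≤4 ≤2)
          -- The inside part gives `v` and the rest `v` plus five guesses of at most `4v`, which
          -- leaves a slack of `10v`.
          ... | inj₂ (t , t≤L , 2v< , ≤4v) =
            by (split ⊕ inside-part ⊕ high t≤L 2v< ≤4v ⊕ (≤4v ⊕ (≤4v ⊕ ≤4v ⊕ (≤4v ⊕ ≤4v))) ⊕ ≤10)
            (solve 5 (λ o i r v g → let 2v = v :+ v ; 4v = 2v :+ 2v ; 8v = 4v :+ 4v ; 16v = 8v :+ 8v
                                        5g = g :+ (g :+ g :+ (g :+ g)) in
                o :+ (((((i :+ r) :+ v) :+ (v :+ 5g)) :+ (4v :+ (4v :+ 4v :+ (4v :+ 4v)))) :+ (8v :+ 2v))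
                  := (16v :+ 16v) :+ ((((o :+ i) :+ r) :+ 5g) :+ con 0ℚ)) refl (f O) (f (O ∩ 𝒮)) (f (O ∖ 𝒮)) v (guess t))
            where
            ≤2 = +-nonNeg 0≤v 0≤v
            ≤4 = +-nonNeg ≤2 ≤2
            ≤10 : 0ℚ ≤ (v + v) + (v + v) + ((v + v) + (v + v)) + (v + v)
            ≤10 = +-nonNeg (+-nonNeg ≤4 ≤4) ≤2

        guesses-robust : Robust 𝒮
        guesses-robust = robust 𝒮 λ E Z O ∣E∣≤m best O⊆ cO → Bound.bound ∣E∣≤m best O⊆ cO

      guessed : ∃[ 𝒮 ] (∣ 𝒮 ∣ ℕ.≤ SoftBound 81 4 K m × Robust 𝒮)
      guessed = 𝒮 , ∣𝒮∣≤ , guesses-robust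
        where open Union (λ t → proj₁ (guess-summary t)) (λ t → proj₂ (guess-summary t))

  exists : Parameters (natFloor K) m → ∃[ 𝒮 ] (∣ 𝒮 ∣ ℕ.≤ SoftBound 81 4 K m × Robust 𝒮)
  exists params = from-top (top f affordable (suc m))
    where
    open Guesses params
    whole : ∀ {T} → ∣ T ∣ ℕ.≤ suc m → affordable ⊆ T → ∃[ 𝒮 ] (∣ 𝒮 ∣ ℕ.≤ SoftBound 81 4 K m × Robust 𝒮)
    whole {T} ∣T∣≤ ⊆T = T , ℕₚ.≤-trans ∣T∣≤ (ℕₚ.≤-trans (ℕₚ.m≤m+n (suc m) _) (Parameters.size params)) , covers-affordable ⊆T
    from-top : ∃[ T ] (T ⊆ affordable × ∣ T ∣ ℕ.≤ suc m ×
      (affordable ⊆ T ⊎ (suc m ℕ.≤ ∣ T ∣ × (∀ x e → x ∈ T → e ∈ affordable ∖ T → f ⁅ e ⁆ ≤ f ⁅ x ⁆)))) →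
      ∃[ 𝒮 ] (∣ 𝒮 ∣ ℕ.≤ SoftBound 81 4 K m × Robust 𝒮)
    from-top (T , T⊆ , ∣T∣≤ , inj₁ ⊆T) = whole ∣T∣≤ ⊆T
    from-top (T , T⊆ , ∣T∣≤ , inj₂ (m<∣T∣ , above)) = from-best (best-element f (affordable ∖ T))
      where
      from-best : (∃[ e ] (e ∈ affordable ∖ T × (∀ x → x ∈ affordable ∖ T → f ⁅ x ⁆ ≤ f ⁅ e ⁆))) ⊎
                  (∀ x → x ∉ affordable ∖ T) → ∃[ 𝒮 ] (∣ 𝒮 ∣ ℕ.≤ SoftBound 81 4 K m × Robust 𝒮)
      from-best (inj₂ empty)         = whole ∣T∣≤ (empty-∖ affordable T empty)
      -- `Δ` is the value of the best affordable singleton outside `T`: it bounds all others there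
      -- and is at most every value in `T`.
      from-best (inj₁ (e , e∈ , max)) =
        guessed T⊆ ∣T∣≤ m<∣T∣ (0≤f ⁅ e ⁆) (λ x x∈T → above x e x∈T e∈) max

theorem5 : ∃[ α ] ∃[ C ] ∃[ d ] (0ℚ < α × RobustSummary α C d)
theorem5 = half 5 , 81 , 4 , positive⁻¹ (half 5) , λ n f c K m 0≤f mono submod 1≤c 0≤K →
  let 𝒮 , ∣𝒮∣≤ , robust = Summary.exists m 0≤f mono submod 1≤c 0≤K (parameters (natFloor K) m)
  in 𝒮 , ∣𝒮∣≤ , λ E ∣E∣≤m → let Z , (Z⊆ , cZ) , opt = robust E ∣E∣≤m in Z , Z⊆ , cZ , opt
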